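{- There is a deterministic algorithm that, given the vertex set $V$ (with $|V|=n$) of a hidden simple, connected, unweighted, undirected graph $G=(V,E)$, access to the shortest path distance oracle of $G$, and an integer $\tau \geq \mathrm{tl}(G)$, reconstructs $G$ (i.e. determines $E$) using at most $O(\Delta^{3\tau+2}\cdot n\log n)$ oracle queries, where $\Delta$ is the maximum degree of $G$.
   Context: Shortest path (SP) distance oracle: a query takes two vertices $u,v\in V$ and returns $d_G(u,v)$, the length of a shortest $u$-$v$ path in $G$. Reconstruction means determining the edge set $E$ exactly. A tree decomposition of $G$ is a pair $(T,\{V_t\}_{t\in V(T)})$ with $T$ a tree and $V_t\subseteq V$ such that every vertex lies in some bag $V_t$, every edge has both endpoints in some bag, and for each vertex $v$ the set $\{t: v\in V_t\}$ induces a connected subtree of $T$. The treelength $\mathrm{tl}(G)$ is the minimum integer $j$ such that $G$ has a tree decomposition in which $d_G(u,v)\le j$ for all $u,v$ lying in a common bag. -}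

module Defs where

open import Data.Nat using (ℕ; zero; suc; _+_; _*_; _≤_; _⊔_)
open import Data.Bool using (Bool; true; false; if_then_else_)
open import Data.Fin using (Fin; zero; suc; inject₁; fromℕ)
open import Data.Product using (Σ; ∃; _×_; _,_; proj₁; proj₂)
open import Relation.Binary.PropositionalEquality using (_≡_)
open import Relation.Nullary using (¬_)
open import Function using (_∘_)
open import Function.Definitions using (Injective)

record Graph (n : ℕ) : Set where
  field
    adj    : Fin n → Fin n → Bool
    sym    : ∀ u v → adj u v ≡ adj v u
    irrefl : ∀ v → adj v v ≡ false
open Graph public

data WalkR {n : ℕ} (R : Fin n → Fin n → Set) : Fin n → Fin n → ℕ → Set where
  here : ∀ {u} → WalkR R u u zero
  step : ∀ {u w v k} → R u w → WalkR R w v k → WalkR R u v (suc k)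

Edge : ∀ {n} → Graph n → Fin n → Fin n → Set
Edge G u w = adj G u w ≡ true

Walk : ∀ {n} → Graph n → Fin n → Fin n → ℕ → Set
Walk G = WalkR (Edge G)

Connected : ∀ {n} → Graph n → Set
Connected G = ∀ u v → ∃ λ k → Walk G u v k

IsDist : ∀ {n} → Graph n → Fin n → Fin n → ℕ → Set
IsDist G u v k = Walk G u v k × (∀ j → Walk G u v j → k ≤ j)

IsDistOracle : ∀ {n} → Graph n → (Fin n → Fin n → ℕ) → Set
IsDistOracle G D = ∀ u v → IsDist G u v (D u v)

HasCycle : ∀ {m} → Graph m → Set
HasCycle {m} T = Σ ℕ λ k → Σ (Fin (suc (suc (suc k))) → Fin m) λ c →
  Injective _≡_ _≡_ c ×
  (∀ (i : Fin (suc (suc k))) → Edge T (c (inject₁ i)) (c (suc i))) ×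
  Edge T (c (fromℕ (suc (suc k)))) (c zero)

IsTree : ∀ {m} → Graph m → Set
IsTree T = Connected T × ¬ HasCycle T

InducedEdge : ∀ {m} → Graph m → (Fin m → Set) → Fin m → Fin m → Set
InducedEdge T P s t = P s × P t × Edge T s t

record TreeDecomposition {n : ℕ} (G : Graph n) : Set₁ where
  field
    m       : ℕ
    T       : Graph m
    isTree  : IsTree T
    bag     : Fin m → Fin n → Bool
    covers  : ∀ v → ∃ λ t → bag t v ≡ true
    edges   : ∀ u v → Edge G u v → ∃ λ t → bag t u ≡ true × bag t v ≡ true
    subtree : ∀ v s t → bag s v ≡ true → bag t v ≡ true →
              ∃ λ k → WalkR (InducedEdge T (λ r → bag r v ≡ true)) s t k
open TreeDecomposition public

TreeLengthAtMost : ∀ {n} → Graph n → ℕ → Set₁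
TreeLengthAtMost G τ = Σ (TreeDecomposition G) λ TD →
  ∀ t u v → bag TD t u ≡ true → bag TD t v ≡ true →
  ∀ k → IsDist G u v k → k ≤ τ

count : ∀ {n} → (Fin n → Bool) → ℕ
count {zero}  f = zero
count {suc n} f = (if f zero then 1 else 0) + count (f ∘ suc)

maxOver : ∀ {n} → (Fin n → ℕ) → ℕ
maxOver {zero}  f = zero
maxOver {suc n} f = f zero ⊔ maxOver (f ∘ suc)

degree : ∀ {n} → Graph n → Fin n → ℕ
degree G v = count (adj G v)

maxDegree : ∀ {n} → Graph n → ℕ
maxDegree G = maxOver (degree G)

-- Deterministic adaptive query algorithms (decision trees) over Fin n:
-- either output an edge set, or query d(u,v) and continue on the answer.
data QueryTree (n : ℕ) : Set where
  done : (Fin n → Fin n → Bool) → QueryTree n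
  ask  : Fin n → Fin n → (ℕ → QueryTree n) → QueryTree n

run : ∀ {n} → QueryTree n → (Fin n → Fin n → ℕ) → (Fin n → Fin n → Bool) × ℕ
run (done E)    D = E , zero
run (ask u v k) D with run (k (D u v)) D
... | E , q = E , suc q

Algorithm : Set
Algorithm = (n τ : ℕ) → QueryTree n

{-# OPTIONS --safe #-}
-- Query the depth D r x of every vertex, then reconstruct the breadth-first layers of r one at a time.
--
-- A vertex x is an ancestor of v iff D x v + depth x = depth v, which one query decides. To find a parent
-- of v, cut the part W of the known graph that still contains the descending geodesics to v by a minimum
-- balanced set and query the cut: from a child of its deepest ancestor of v (or from the old starting
-- point, if there is none) these geodesics avoid the cut and stay in one component, at most half of W.
-- Some bag is balanced and lies in a ball of radius τ, so a round costs O(Δ^τ + Δ) queries.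
--
-- Vertices of depth l joined by a walk at depth at least l are at distance at most 3τ, and so are their
-- parents, recursively. Hence the neighbours of v in its own and the previous layer are found among the
-- vertices near the parent of v and the children of these: O(Δ^(3τ+1)) further queries.
--
-- Both facts about bags come from the Helly property: pairwise intersecting connected vertex sets are
-- all met by a single bag.
module Submission where

open import Defs hiding (sym)
open import Data.Bool using (Bool; true; false; not; _∧_; _∨_; if_then_else_)
import Data.Bool.Properties as Bool
open import Data.Empty using (⊥; ⊥-elim)
open import Data.Fin using (Fin; zero; suc; _≟_; inject₁; fromℕ)
open import Data.Fin.Properties using (any?; all?; ¬∀⟶∃¬; 0≢1+n; suc-injective)
open import Data.Fin.Subset using (Subset; ⊤)
open import Data.Fin.Subset.Properties using (anySubset?)
open import Data.Nat as ℕ using (ℕ; zero; suc; _+_; _*_; _^_; _∸_; _≤_; _<_; _≤?_; z≤n; s≤s; ⌈_/2⌉)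
open import Data.Nat.Induction using (<-rec)
open import Data.Nat.Logarithm using (⌈log₂_⌉; ⌈log₂⌈n/2⌉⌉≡⌈log₂n⌉∸1; ⌈log₂⌉-mono-≤)
import Data.Nat.Properties as ℕ
open import Data.Nat.Solver using (module +-*-Solver)
open import Data.Product using (Σ; ∃; _×_; _,_; proj₁; proj₂)
open import Data.Sum using (_⊎_; inj₁; inj₂; [_,_]′)
open import Data.Unit using (tt) renaming (⊤ to Unit)
open import Data.Vec using (lookup; tabulate)
open import Data.Vec.Functional using (_∷_)
open import Data.Vec.Properties using (lookup∘tabulate; lookup-replicate)
open import Function using (_∘_; id)
open import Function.Definitions using (Injective)
open import Relation.Binary.PropositionalEquality
  using (_≡_; _≢_; refl; sym; trans; cong; cong₂; subst)
open import Relation.Nullary using (¬_; Dec; yes; no; does; contradiction)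
open import Relation.Nullary.Decidable
  using (dec-true; dec-false; decidable-stable; _×-dec_; _→-dec_)

does⇒ : ∀ {a} {P : Set a} (P? : Dec P) → does P? ≡ true → P
does⇒ (yes p) _ = p

∧⇒ : ∀ {a b} → a ∧ b ≡ true → a ≡ true × b ≡ true
∧⇒ {true} {true} _ = refl , refl

⇒∧ : ∀ {a b} → a ≡ true → b ≡ true → a ∧ b ≡ true
⇒∧ refl refl = refl

true≢false : ∀ {b} → b ≡ true → b ≢ false
true≢false refl ()

-- Counting

_⊑_ : ∀ {n} → (Fin n → Bool) → (Fin n → Bool) → Set
f ⊑ g = ∀ x → f x ≡ true → g x ≡ true

bit : Bool → ℕ
bit b = if b then 1 else 0

interchange : ∀ a b c d → (a + b) + (c + d) ≡ (a + c) + (b + d)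
interchange = solve 4 (λ a b c d → (a :+ b) :+ (c :+ d) := (a :+ c) :+ (b :+ d)) refl
  where open +-*-Solver

count-mono : ∀ {n} {f g : Fin n → Bool} → f ⊑ g → count f ≤ count g
count-mono {zero} _ = z≤n
count-mono {suc n} {f} {g} f⊑g = ℕ.+-mono-≤ (head (f zero) (g zero) (f⊑g zero)) (count-mono (f⊑g ∘ suc))
  where
  head : ∀ b c → (b ≡ true → c ≡ true) → bit b ≤ bit c
  head false _ _ = z≤n
  head true c b⇒c rewrite b⇒c refl = ℕ.≤-refl

count-∪ : ∀ {n} {f g h : Fin n → Bool} → (∀ x → f x ≡ true → g x ≡ true ⊎ h x ≡ true) →
          count f ≤ count g + count h
count-∪ {zero} _ = z≤n
count-∪ {suc n} {f} {g} {h} f⊑ = begin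
  bit (f zero) + count (f ∘ suc)
    ≤⟨ ℕ.+-mono-≤ (head (f zero) (f⊑ zero)) (count-∪ (f⊑ ∘ suc)) ⟩
  (bit (g zero) + bit (h zero)) + (count (g ∘ suc) + count (h ∘ suc))
    ≡⟨ interchange (bit (g zero)) _ _ _ ⟩
  count g + count h ∎
  where
  open ℕ.≤-Reasoning
  head : ∀ b {c d} → (b ≡ true → c ≡ true ⊎ d ≡ true) → bit b ≤ bit c + bit d
  head false _ = z≤n
  head true {c} {d} b⇒ with b⇒ refl
  ... | inj₁ refl = s≤s z≤n
  ... | inj₂ refl = ℕ.m≤n+m 1 (bit c)

count-disjoint : ∀ {n} {f g h : Fin n → Bool} → f ⊑ h → g ⊑ h → (∀ x → f x ≡ true → g x ≢ true) →
                 count f + count g ≤ count h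
count-disjoint {zero} _ _ _ = z≤n
count-disjoint {suc n} {f} {g} {h} f⊑h g⊑h dis = begin
  count f + count g
    ≡⟨ interchange (bit (f zero)) _ _ _ ⟩
  (bit (f zero) + bit (g zero)) + (count (f ∘ suc) + count (g ∘ suc))
    ≤⟨ ℕ.+-mono-≤ (head (f zero) (g zero) (f⊑h zero) (g⊑h zero) (dis zero))
         (count-disjoint (f⊑h ∘ suc) (g⊑h ∘ suc) (dis ∘ suc)) ⟩
  count h ∎
  where
  open ℕ.≤-Reasoning
  head : ∀ b c {d} → (b ≡ true → d ≡ true) → (c ≡ true → d ≡ true) → (b ≡ true → c ≢ true) →
         bit b + bit c ≤ bit d
  head false false _ _ _ = z≤n
  head false true _ c⇒d _ rewrite c⇒d refl = ℕ.≤-refl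
  head true false b⇒d _ _ rewrite b⇒d refl = ℕ.≤-refl
  head true true _ _ b∦c = contradiction refl (b∦c refl)

count-positive : ∀ {n} {f : Fin n → Bool} v → f v ≡ true → 1 ≤ count f
count-positive zero fv rewrite fv = s≤s z≤n
count-positive {f = f} (suc v) fv = ℕ.≤-trans (count-positive v fv) (ℕ.m≤n+m _ (bit (f zero)))

count≤n : ∀ {n} (f : Fin n → Bool) → count f ≤ n
count≤n {zero} f = z≤n
count≤n {suc n} f with f zero
... | true  = s≤s (count≤n (f ∘ suc))
... | false = ℕ.m≤n⇒m≤1+n (count≤n (f ∘ suc))

count-none : ∀ {n} {f : Fin n → Bool} → (∀ x → f x ≢ true) → count f ≡ 0
count-none {zero} _ = refl
count-none {suc n} {f} none rewrite Bool.¬-not (none zero) = count-none (none ∘ suc)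

singleton : ∀ {n} → Fin n → Fin n → Bool
singleton v x = does (x ≟ v)

count-⊂ : ∀ {n} {f g : Fin n → Bool} v → f ⊑ g → f v ≡ false → g v ≡ true → count f < count g
count-⊂ {f = f} {g} v f⊑g ¬fv gv = begin
  1 + count f                   ≤⟨ ℕ.+-monoˡ-≤ (count f) (count-positive {f = singleton v} v (dec-true (v ≟ v) refl)) ⟩
  count (singleton v) + count f ≤⟨ count-disjoint single⊑g f⊑g v∉f ⟩
  count g                       ∎
  where
  open ℕ.≤-Reasoning
  v∉f : ∀ x → singleton v x ≡ true → f x ≢ true
  v∉f x x≡v fx = true≢false (subst (λ y → f y ≡ true) (does⇒ (x ≟ v) x≡v) fx) ¬fv
  single⊑g : singleton v ⊑ g
  single⊑g x x≡v = subst (λ y → g y ≡ true) (sym (does⇒ (x ≟ v) x≡v)) gv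

count<n : ∀ {n} {f : Fin n → Bool} v → f v ≡ false → count f < n
count<n {n} v ¬fv = ℕ.≤-trans (count-⊂ {g = λ _ → true} v (λ _ _ → refl) ¬fv refl) (count≤n _)

count-unique : ∀ {n} {f : Fin n → Bool} → (∀ x y → f x ≡ true → f y ≡ true → x ≡ y) → count f ≤ 1
count-unique {zero} _ = z≤n
count-unique {suc n} {f} uniq with f zero in f0
... | false = count-unique (λ x y fx fy → suc-injective (uniq (suc x) (suc y) fx fy))
... | true  = s≤s (ℕ.≤-reflexive (count-none (λ x fx → contradiction (uniq zero (suc x) f0 fx) 0≢1+n)))

count-unique⁻¹ : ∀ {n} {f : Fin n → Bool} → count f ≤ 1 → ∀ {x y} → f x ≡ true → f y ≡ true → x ≡ y
count-unique⁻¹ {f = f} f≤1 {x} {y} fx fy = decidable-stable (x ≟ y) λ x≢y →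
  contradiction (ℕ.≤-trans (ℕ.≤-trans (s≤s (count-positive {f = singleton x} x (dec-true (x ≟ x) refl)))
    (count-⊂ y single⊑f (dec-false (y ≟ x) (x≢y ∘ sym)) fy)) f≤1) λ { (s≤s ()) }
  where
  single⊑f : singleton x ⊑ f
  single⊑f z z≡x = subst (λ w → f w ≡ true) (sym (does⇒ (z ≟ x) z≡x)) fx

count-⋃ : ∀ {m n d} (s : Fin m → Bool) (h : Fin m → Fin n → Bool) {f : Fin n → Bool} →
          (∀ x → f x ≡ true → ∃ λ i → s i ≡ true × h i x ≡ true) → (∀ i → count (h i) ≤ d) →
          count f ≤ count s * d
count-⋃ {zero} s h f⊑ _ = ℕ.≤-reflexive (count-none λ x fx → case-empty (f⊑ x fx))
  where
  case-empty : ∀ {P : Fin 0 → Set} → ∃ P → ⊥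
  case-empty (() , _)
count-⋃ {suc m} {d = d} s h {f} f⊑ h≤d with s zero in s0
... | false = count-⋃ (s ∘ suc) (h ∘ suc) rest (h≤d ∘ suc)
  where
  rest : ∀ x → f x ≡ true → ∃ λ i → s (suc i) ≡ true × h (suc i) x ≡ true
  rest x fx with f⊑ x fx
  ... | zero , sz , _ = contradiction s0 (true≢false sz)
  ... | suc i , p = i , p
... | true = begin
  count f                                 ≤⟨ count-∪ split ⟩
  count (h zero) + count f′               ≤⟨ ℕ.+-mono-≤ (h≤d zero) (count-⋃ (s ∘ suc) (h ∘ suc) rest (h≤d ∘ suc)) ⟩
  d + count (s ∘ suc) * d                 ∎
  where
  open ℕ.≤-Reasoning
  -- Elements already covered by `h zero` are removed, so the rest must be covered by a later index
  -- and the induction hypothesis applies.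
  f′ : _ → Bool
  f′ x = f x ∧ not (h zero x)
  split : ∀ x → f x ≡ true → h zero x ≡ true ⊎ f′ x ≡ true
  split x fx with h zero x
  ... | true  = inj₁ refl
  ... | false = inj₂ (⇒∧ fx refl)
  rest : ∀ x → f′ x ≡ true → ∃ λ i → s (suc i) ≡ true × h (suc i) x ≡ true
  rest x f′x with ∧⇒ {f x} f′x
  ... | fx , ¬hx with f⊑ x fx
  ... | suc i , p = i , p
  ... | zero , _ , hx rewrite hx = contradiction ¬hx λ ()

maxOver-upper : ∀ {n} (f : Fin n → ℕ) i → f i ≤ maxOver f
maxOver-upper f zero    = ℕ.m≤m⊔n _ _
maxOver-upper f (suc i) = ℕ.≤-trans (maxOver-upper (f ∘ suc) i) (ℕ.m≤n⊔m (f zero) _)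

least : ∀ {a} {P : ℕ → Set a} → (∀ k → Dec (P k)) → ∀ k → P k → ∃ λ l → P l × (∀ j → P j → l ≤ j)
least P? k Pk with P? 0
least P? k Pk | yes P0 = 0 , P0 , λ _ _ → z≤n
least P? zero P0 | no ¬P0 = contradiction P0 ¬P0
least {P = P} P? (suc k) Pk | no ¬P0 with least (P? ∘ suc) k Pk
... | l , Pl , min = suc l , Pl , λ { zero P0 → contradiction P0 ¬P0 ; (suc j) Pj → s≤s (min j Pj) }

argmax : ∀ {n} {P : Fin n → Set} → (∀ i → Dec (P i)) → (f : Fin n → ℕ) →
         (∀ i → ¬ P i) ⊎ ∃ λ i → P i × (∀ j → P j → f j ≤ f i)
argmax {zero} _ _ = inj₁ λ ()
argmax {suc n} P? f with P? zero | argmax (P? ∘ suc) (f ∘ suc)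
... | no ¬p₀ | inj₁ none = inj₁ λ { zero → ¬p₀ ; (suc i) → none i }
... | no ¬p₀ | inj₂ (i , pi , max) = inj₂ (suc i , pi , λ { zero p₀ → contradiction p₀ ¬p₀ ; (suc j) → max j })
... | yes p₀ | inj₁ none = inj₂ (zero , p₀ , λ { zero _ → ℕ.≤-refl ; (suc j) pj → contradiction pj (none j) })
... | yes p₀ | inj₂ (i , pi , max) with ℕ.≤-total (f zero) (f (suc i))
...   | inj₁ f₀≤fi = inj₂ (suc i , pi , λ { zero _ → f₀≤fi ; (suc j) → max j })
...   | inj₂ fi≤f₀ = inj₂ (zero , p₀ , λ { zero _ → ℕ.≤-refl ; (suc j) pj → ℕ.≤-trans (max j pj) fi≤f₀ })

argmin : ∀ {n} {P : Fin n → Set} → (∀ i → Dec (P i)) → (f : Fin n → ℕ) →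
         ∃ P → ∃ λ i → P i × (∀ j → P j → f i ≤ f j)
argmin P? f (i , pi) with least (λ k → any? λ i → P? i ×-dec (f i ℕ.≟ k)) (f i) (i , pi , refl)
... | _ , (j , pj , refl) , min = j , pj , λ k pk → min (f k) (k , pk , refl)

-- Walks and distances

Linked : ∀ {n} → (Fin n → Fin n → Set) → Fin n → Fin n → Set
Linked R u v = ∃ λ k → WalkR R u v k

module _ {n} {R : Fin n → Fin n → Set} where

  walk-++ : ∀ {u v w k l} → WalkR R u v k → WalkR R v w l → WalkR R u w (k + l)
  walk-++ here       q = q
  walk-++ (step e p) q = step e (walk-++ p q)

  walk-snoc : ∀ {u v w k} → WalkR R u v k → R v w → WalkR R u w (suc k)
  walk-snoc here       e = step e here
  walk-snoc (step d p) e = step d (walk-snoc p e)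

  walk-reverse : (∀ {x y} → R x y → R y x) → ∀ {u v k} → WalkR R u v k → WalkR R v u k
  walk-reverse R-sym here       = here
  walk-reverse R-sym (step e p) = walk-snoc (walk-reverse R-sym p) (R-sym e)

  walk-map : ∀ {S : Fin n → Fin n → Set} → (∀ {x y} → R x y → S x y) → ∀ {u v k} → WalkR R u v k → WalkR S u v k
  walk-map f here       = here
  walk-map f (step e p) = step (f e) (walk-map f p)

  linked-refl : ∀ {u} → Linked R u u
  linked-refl = 0 , here

  linked-trans : ∀ {u v w} → Linked R u v → Linked R v w → Linked R u w
  linked-trans (_ , p) (_ , q) = _ , walk-++ p q

  linked-snoc : ∀ {u v w} → Linked R u v → R v w → Linked R u w
  linked-snoc (_ , p) e = _ , walk-snoc p e

  linked-sym : (∀ {x y} → R x y → R y x) → ∀ {u v} → Linked R u v → Linked R v u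
  linked-sym R-sym (_ , p) = _ , walk-reverse R-sym p

linked-map : ∀ {n} {R S : Fin n → Fin n → Set} → (∀ {x y} → R x y → S x y) → ∀ {u v} → Linked R u v → Linked S u v
linked-map f (_ , p) = _ , walk-map f p

edge-sym : ∀ {n} (G : Graph n) {x y} → Edge G x y → Edge G y x
edge-sym G {x} {y} = trans (Graph.sym G y x)

inducedEdge-sym : ∀ {n} (G : Graph n) {P : Fin n → Set} {x y} → InducedEdge G P x y → InducedEdge G P y x
inducedEdge-sym G (Px , Py , e) = Py , Px , edge-sym G e

module Metric {n} (G : Graph n) (D : Fin n → Fin n → ℕ) (isD : IsDistOracle G D) where

  D≤ : ∀ {u v k} → Walk G u v k → D u v ≤ k
  D≤ {u} {v} = proj₂ (isD u v) _

  D-refl : ∀ u → D u u ≡ 0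
  D-refl u = ℕ.n≤0⇒n≡0 (D≤ here)

  D≡0⇒≡ : ∀ {u v} → D u v ≡ 0 → u ≡ v
  D≡0⇒≡ {u} {v} Duv≡0 with D u v | proj₁ (isD u v)
  D≡0⇒≡ refl | .0 | here = refl

  D-sym : ∀ u v → D u v ≡ D v u
  D-sym u v = ℕ.≤-antisym (half u v) (half v u)
    where
    half : ∀ u v → D u v ≤ D v u
    half u v = D≤ (walk-reverse (edge-sym G) (proj₁ (isD v u)))

  D-triangle : ∀ u v w → D u w ≤ D u v + D v w
  D-triangle u v w = D≤ (walk-++ (proj₁ (isD u v)) (proj₁ (isD v w)))

  edge⇒D≡1 : ∀ {u v} → Edge G u v → D u v ≡ 1
  edge⇒D≡1 {u} {v} e with D u v in Duv | D≤ {u} {v} (step e here)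
  ... | zero | _ = contradiction (Graph.irrefl G u)
                     (true≢false (subst (Edge G u) (sym (D≡0⇒≡ Duv)) e))
  ... | suc zero | _ = refl
  ... | suc (suc _) | s≤s ()

  D≡1⇒edge : ∀ {u v} → D u v ≡ 1 → Edge G u v
  D≡1⇒edge {u} {v} Duv≡1 with D u v | proj₁ (isD u v)
  D≡1⇒edge refl | .1 | step e here = e

  D-edge : ∀ u {v w} → Edge G v w → D u w ≤ suc (D u v)
  D-edge u {v} e = D≤ (walk-snoc (proj₁ (isD u v)) e)

  predecessor : ∀ u v {k} → D u v ≡ suc k → ∃ λ w → Edge G w v × D u w ≡ k
  predecessor u v Duv with D v u | trans (D-sym v u) Duv | proj₁ (isD v u)
  predecessor u v {k} Duv | .(suc k) | refl | step {w = w} e p =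
    w , edge-sym G e , ℕ.≤-antisym (D≤ (walk-reverse (edge-sym G) p))
      (ℕ.≤-pred (subst (λ d → d ≤ suc (D u w)) Duv (D-edge u (edge-sym G e))))

  -- The metric interval of `r` and `u`, that is, the union of all geodesics from `r` to `u`.
  Between : Fin n → Fin n → Fin n → Set
  Between r u z = D r z + D z u ≡ D r u

  -- A step back from `z` towards `r` raises the distance to `u` by at most one, so the triangle
  -- inequality stays tight and the predecessor lies in the interval too. Intervals are thus
  -- connected sets, fit for the Helly property.
  between-linked : ∀ r u z → Between r u z → Linked (InducedEdge G (Between r u)) r z
  between-linked r u z btw = go (D r z) z refl btw
    where
    go : ∀ k z → D r z ≡ k → Between r u z → Linked (InducedEdge G (Between r u)) r z
    go zero z Drz _ rewrite D≡0⇒≡ Drz = linked-refl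
    go (suc k) z Drz btw with predecessor r z Drz
    ... | w , e , Drw = linked-snoc (go k w Drw btw-w) (btw-w , btw , e)
      where
      btw-w : Between r u w
      btw-w = ℕ.≤-antisym (begin
        D r w + D w u         ≡⟨ cong₂ _+_ Drw (D-sym w u) ⟩
        k + D u w             ≤⟨ ℕ.+-monoʳ-≤ k (D-edge u (edge-sym G e)) ⟩
        k + suc (D u z)       ≡⟨ ℕ.+-suc k _ ⟩
        suc k + D u z         ≡⟨ cong₂ _+_ (sym Drz) (D-sym u z) ⟩
        D r z + D z u         ≡⟨ btw ⟩
        D r u                 ∎) (D-triangle r w u)
        where open ℕ.≤-Reasoning

walk? : ∀ {n} (G : Graph n) k u v → Dec (Walk G u v k)
walk? G zero u v with u ≟ v
... | yes refl = yes here
... | no u≢v = no λ { here → u≢v refl }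
walk? G (suc k) u v with any? (λ w → (adj G u w Bool.≟ true) ×-dec walk? G k w v)
... | yes (_ , e , p) = yes (step e p)
... | no ¬p = no λ { (step e p) → ¬p (_ , e , p) }

shortest : ∀ {n} (G : Graph n) {u v} → Linked (Edge G) u v → ∃ (IsDist G u v)
shortest G {u} {v} (k , p) = least (λ k → walk? G k u v) k p

distances : ∀ {n} (G : Graph n) → Connected G → ∃ (IsDistOracle G)
distances G conn = (λ u v → proj₁ (shortest G (conn u v))) , (λ u v → proj₂ (shortest G (conn u v)))

-- Trees and tree decompositions

-- A repeated vertex would shorten the walk. The last component carries what this argument needs:
-- from every listed vertex the target is reached in at most `k` steps.
geodesic : ∀ {n} (G : Graph n) {u v k} → IsDist G u v k →
  Σ (Fin (suc k) → Fin n) λ c → Injective _≡_ _≡_ c × c zero ≡ u × c (fromℕ k) ≡ v ×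
  (∀ i → Edge G (c (inject₁ i)) (c (suc i))) × (∀ i → ∃ λ l → l ≤ k × Walk G (c i) v l)
geodesic G {u} (here , _) =
  (λ _ → u) , (λ { {zero} {zero} _ → refl }) , refl , refl , (λ ()) , λ _ → 0 , z≤n , here
geodesic G {u} (step {w = w} e p , min)
  with geodesic G (p , λ j q → ℕ.≤-pred (min (suc j) (step e q)))
... | c , inj , refl , cv , edges , rest =
  (u ∷ c) , inj′ , refl , cv , (λ { zero → e ; (suc i) → edges i }) ,
  λ { zero → _ , ℕ.≤-refl , step e p ; (suc i) → let l , l≤k , q = rest i in l , ℕ.m≤n⇒m≤1+n l≤k , q }
  where
  u∉c : ∀ i → u ≢ c i
  u∉c i refl with rest i
  ... | l , l≤k , q = ℕ.<⇒≱ (min l q) l≤k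
  inj′ : Injective _≡_ _≡_ (u ∷ c)
  inj′ {zero}  {zero}  _  = refl
  inj′ {zero}  {suc j} eq = contradiction eq (u∉c j)
  inj′ {suc i} {zero}  eq = contradiction (sym eq) (u∉c i)
  inj′ {suc i} {suc j} eq = cong suc (inj eq)

inside : ∀ {n} → (Fin n → Bool) → (Fin n → Fin n → Bool) → Fin n → Fin n → Bool
inside M e x y = M x ∧ (M y ∧ e x y)

inside⇒ : ∀ {n} (M : Fin n → Bool) (e : Fin n → Fin n → Bool) {x y} → inside M e x y ≡ true →
          M x ≡ true × M y ≡ true × e x y ≡ true
inside⇒ M e i = let Mx , i′ = ∧⇒ i in Mx , ∧⇒ i′

-- Vertices outside `M` are kept but isolated, so the result is again a `Graph n` to which
-- `shortest` and `geodesic` apply.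
restrict : ∀ {n} → (Fin n → Bool) → Graph n → Graph n
restrict M G = record
  { adj    = inside M (adj G)
  ; sym    = λ u v → swap (M u) (M v) (Graph.sym G u v)
  ; irrefl = λ v → loop (M v) (Graph.irrefl G v)
  }
  where
  swap : ∀ a b {x y} → x ≡ y → a ∧ (b ∧ x) ≡ b ∧ (a ∧ y)
  swap false false refl = refl
  swap false true  refl = refl
  swap true  false refl = refl
  swap true  true  refl = refl
  loop : ∀ a {x} → x ≡ false → a ∧ (a ∧ x) ≡ false
  loop false refl = refl
  loop true  refl = refl

others : ∀ {n} → Fin n → Fin n → Bool
others x z = not (does (z ≟ x))

others⇒≢ : ∀ {n} (x z : Fin n) → others x z ≡ true → z ≢ x
others⇒≢ x z o refl rewrite dec-true (x ≟ x) refl = contradiction o λ ()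

-- A shortest path from `y` to `y′` in the graph with `x` isolated is simple and avoids `x`; the two
-- edges at `x` close it to a cycle.
cycle-through : ∀ {n} (G : Graph n) {x y y′} → Edge G x y → Edge G x y′ → y ≢ y′ →
                Linked (InducedEdge G (_≢ x)) y y′ → HasCycle G
cycle-through {n} G {x} {y} {y′} e e′ y≢y′ link
  with shortest (restrict (others x) G) (linked-map keep link)
  where
  keep : ∀ {a b} → InducedEdge G (_≢ x) a b → Edge (restrict (others x) G) a b
  keep {a} {b} (a≢x , b≢x , e) rewrite dec-false (a ≟ x) a≢x | dec-false (b ≟ x) b≢x = e
-- As `y` and `y′` differ, the path has an edge, so the cycle has at least the three vertices that
-- `HasCycle` demands.
... | zero , here , _ = ⊥-elim (y≢y′ refl)
... | suc k , geo with geodesic (restrict (others x) G) geo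
...   | c , inj , refl , cy′ , edges , rest =
  k , (x ∷ c) , inj′ ,
  (λ { zero → e
     ; (suc i) → proj₂ (proj₂ (inside⇒ (others x) (adj G) {c (inject₁ i)} {c (suc i)} (edges i))) }) ,
  subst (λ z → Edge G z x) (sym cy′) (edge-sym G e′)
  where
  x≢nbr : ∀ {z} → Edge G x z → x ≢ z
  x≢nbr e refl = true≢false e (Graph.irrefl G x)
  x∉c : ∀ i → x ≢ c i
  -- A path vertex is either the end `y′`, a neighbour of `x`, or it has an edge in the restricted
  -- graph, where `x` is isolated.
  x∉c i x≡ci with rest i
  ... | _ , _ , here = x≢nbr e′ x≡ci
  ... | _ , _ , step d _ = others⇒≢ x (c i) (proj₁ (inside⇒ (others x) (adj G) {c i} d)) (sym x≡ci)
  inj′ : Injective _≡_ _≡_ (x ∷ c)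
  inj′ {zero}  {zero}  _  = refl
  inj′ {zero}  {suc j} eq = contradiction eq (x∉c j)
  inj′ {suc i} {zero}  eq = contradiction (sym eq) (x∉c i)
  inj′ {suc i} {suc j} eq = cong suc (inj eq)

-- Parents and descendants in a rooted tree

module Rooted {n} (T : Graph n) (isTree : IsTree T) (D : Fin n → Fin n → ℕ) (isD : IsDistOracle T D)
              (root : Fin n) where

  open Metric T D isD

  depth : Fin n → ℕ
  depth = D root

  -- A geodesic from the root to `y` through the neighbour `x` would make `y` deeper than `x`; hence
  -- all of these geodesics avoid `x`.
  to-root : ∀ {x y} → Edge T x y → depth y ≤ depth x → Linked (InducedEdge T (_≢ x)) root y
  to-root {x} {y} e y≤x =
    linked-map (λ { (a , b , d) → avoids a , avoids b , d }) (between-linked root y y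
      (trans (cong (depth y +_) (D-refl y)) (ℕ.+-identityʳ _)))
    where
    avoids : ∀ {z} → Between root y z → z ≢ x
    avoids btw refl = ℕ.1+n≰n (ℕ.≤-trans (ℕ.≤-reflexive (trans (ℕ.+-comm 1 _)
      (trans (cong (depth x +_) (sym (edge⇒D≡1 e))) btw))) y≤x)

  -- Two different such neighbours would be linked through the root without using `x`, which closes
  -- a cycle.
  lower-unique : ∀ {x y y′} → Edge T x y → depth y ≤ depth x → Edge T x y′ → depth y′ ≤ depth x → y ≡ y′
  lower-unique {y = y} {y′} e y≤x e′ y′≤x = decidable-stable (y ≟ y′) λ y≢y′ →
    proj₂ isTree (cycle-through T e e′ y≢y′
      (linked-trans (linked-sym (inducedEdge-sym T) (to-root e y≤x)) (to-root e′ y′≤x)))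

  -- By `lower-unique` a neighbour on the same level would coincide with the predecessor of `x`
  -- towards the root, whose depth is smaller. At depth zero both ends are the root, and the edge
  -- would be a loop.
  level≢ : ∀ {x y} → Edge T x y → depth y ≢ depth x
  level≢ {x} {y} e y≡x with depth x in dx
  ... | zero = true≢false (subst (Edge T x) (trans (sym (D≡0⇒≡ y≡x)) (D≡0⇒≡ dx)) e) (Graph.irrefl T x)
  ... | suc k with predecessor root x dx
  ...   | w , e′ , dw = ℕ.1+n≢n (trans (trans (sym y≡x) (cong depth
            (lower-unique e (ℕ.≤-reflexive (trans y≡x (sym dx))) (edge-sym T e′)
              (ℕ.≤-trans (ℕ.≤-reflexive dw) (ℕ.≤-trans (ℕ.n≤1+n k) (ℕ.≤-reflexive (sym dx)))))))
            dw)

  Lower : Fin n → Fin n → Set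
  Lower x y = Edge T x y × depth y < depth x

  Descendant : Fin n → Fin n → Set
  Descendant a z = Linked Lower z a

  descendant-deeper : ∀ {a z} → Descendant a z → depth a ≤ depth z
  descendant-deeper (_ , here) = ℕ.≤-refl
  descendant-deeper (_ , step (_ , lt) p) = ℕ.≤-trans (descendant-deeper (_ , p)) (ℕ.<⇒≤ lt)

  descendant-minimal : ∀ {a z} → Descendant a z → depth z ≤ depth a → z ≡ a
  descendant-minimal (_ , here) _ = refl
  descendant-minimal (_ , step (_ , lt) p) z≤a = contradiction (ℕ.≤-trans lt z≤a) (ℕ.≤⇒≯ (descendant-deeper (_ , p)))

  -- The subtree below `a` can be left only from `a`: a deeper neighbour prolongs the chain of
  -- parents, and one that is not deeper is the unique parent, hence the next vertex of the chain.
  descendant-edge : ∀ {a z z′} → Descendant a z → Edge T z z′ → z ≡ a ⊎ Descendant a z′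
  descendant-edge {a} {z} {z′} desc e with depth z′ ≤? depth z
  ... | no z′≰z = inj₂ (_ , step (edge-sym T e , ℕ.≰⇒> z′≰z) (proj₂ desc))
  ... | yes z′≤z with desc
  ...   | _ , here = inj₁ refl
  ...   | _ , step (d , lt) p with lower-unique d (ℕ.<⇒≤ lt) e z′≤z
  ...     | refl = inj₂ (_ , p)

  -- To leave the subtree, the walk would have to step from `a` to a vertex that is not deeper.
  -- `above` forbids a shallower one and `level≢` one of equal depth.
  descendant-above : ∀ {a z k} {P : Fin n → Set} → (∀ {x} → P x → depth a ≤ depth x) →
                     WalkR (InducedEdge T P) a z k → Descendant a z
  descendant-above {a} {P = P} above p = go linked-refl p
    where
    go : ∀ {x z k} → Descendant a x → WalkR (InducedEdge T P) x z k → Descendant a z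
    go desc here = desc
    go desc (step (_ , Pw , e) p) with descendant-edge desc e
    ... | inj₂ desc′ = go desc′ p
    ... | inj₁ refl = go (_ , step (edge-sym T e , ℕ.≤∧≢⇒< (above Pw) (level≢ e ∘ sym)) here) p

  -- The walk starts in the subtree below `a` and ends no deeper than `a`, so it visits `a`, the
  -- only exit.
  descendant-exit : ∀ {a s b k} {P : Fin n → Set} → WalkR (InducedEdge T P) s b k → P s → Descendant a s →
                    depth b ≤ depth a → P a
  descendant-exit here Ps desc b≤a = subst _ (descendant-minimal desc b≤a) Ps
  descendant-exit (step (_ , Pw , e) p) Ps desc b≤a with descendant-edge desc e
  ... | inj₁ refl = Ps
  ... | inj₂ desc′ = descendant-exit p Pw desc′ b≤a

-- The Helly property of tree decompositions

module Helly {n} {G : Graph n} (TD : TreeDecomposition G) where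

  Hits : (Fin n → Bool) → Fin (m TD) → Set
  Hits C t = ∃ λ u → bag TD t u ≡ true × C u ≡ true

  hits? : ∀ C t → Dec (Hits C t)
  hits? C t = any? λ u → (bag TD t u Bool.≟ true) ×-dec (C u Bool.≟ true)

  -- The bags containing one vertex form a subtree, and for each edge of the walk a bag containing
  -- both of its ends glues two consecutive subtrees together.
  hits-linked : ∀ {C u v k} → WalkR (InducedEdge G (λ z → C z ≡ true)) u v k → C u ≡ true →
                ∀ {s t} → bag TD s u ≡ true → bag TD t v ≡ true →
                Linked (InducedEdge (T TD) (Hits C)) s t
  hits-linked here Cu {s} {t} su tv =
    linked-map (λ { (a , b , e) → (_ , a , Cu) , (_ , b , Cu) , e }) (subtree TD _ s t su tv)
  hits-linked (step (_ , Cw , e) p) Cu su tv with edges TD _ _ e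
  ... | q , qu , qw = linked-trans (hits-linked here Cu su qu) (hits-linked p Cw qw tv)

  -- The sets hit subtrees of T; the subtree whose top node is deepest has its top in all the others.
  helly : ∀ {N} (C : Fin N → Fin n → Bool) (c : Fin N → Fin n) →
          (∀ i u → C i u ≡ true → Linked (InducedEdge G (λ z → C i z ≡ true)) (c i) u) →
          (∀ i j → ∃ λ u → C i u ≡ true × C j u ≡ true) →
          Fin N → ∃ λ t → ∀ i → Hits (C i) t
  helly {N} C c linked meet i₀ = conclude (argmax {P = λ _ → Unit} (λ _ → yes tt) (depth ∘ top))
    where
    oracle : ∃ (IsDistOracle (T TD))
    oracle = distances (T TD) (proj₁ (isTree TD))
    root : Fin (m TD)
    root = proj₁ (covers TD (proj₁ (meet i₀ i₀)))
    open Rooted (T TD) (isTree TD) (proj₁ oracle) (proj₂ oracle) root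

    lowest : ∀ i → ∃ λ t → Hits (C i) t × (∀ s → Hits (C i) s → depth t ≤ depth s)
    lowest i = let u , Ciu , _ = meet i i ; t , tu = covers TD u in
      argmin (hits? (C i)) depth (t , u , tu , Ciu)

    top : Fin N → Fin (m TD)
    top i = proj₁ (lowest i)

    subtree-linked : ∀ i {s t} → Hits (C i) s → Hits (C i) t → Linked (InducedEdge (T TD) (Hits (C i))) s t
    subtree-linked i (u , su , Cu) (v , tv , Cv) =
      let _ , p = linked-trans (linked-sym (inducedEdge-sym G) (linked i u Cu)) (linked i v Cv) in
      hits-linked p Cu su tv

    conclude : (∀ i → ¬ Unit) ⊎ (∃ λ i → Unit × (∀ j → Unit → depth (top j) ≤ depth (top i))) →
               ∃ λ t → ∀ i → Hits (C i) t
    conclude (inj₁ none) = contradiction tt (none i₀)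
    -- The bag `s` hits both `C i` and `C k`. It lies below `top i`, while `top k` is no deeper than
    -- `top i`; so the walk from `s` to `top k` through bags hit by `C k` passes `top i`.
    conclude (inj₂ (i , _ , deepest)) = top i , λ k →
      let u , Ciu , Cku = meet i k
          s , su        = covers TD u
          _ , top-hits , lowest-i = lowest i
          _ , up        = subtree-linked i top-hits (u , su , Ciu)
          _ , down      = subtree-linked k (u , su , Cku) (proj₁ (proj₂ (lowest k)))
      in descendant-exit down (u , su , Cku) (descendant-above (lowest-i _) up) (deepest k tt)

-- Connected components and separators

walk-target : ∀ {n} {R : Fin n → Fin n → Set} {P : Fin n → Set} → (∀ {x y} → R x y → P y) →
              ∀ {u v k} → P u → WalkR R u v k → P v
walk-target R⇒P Pu here       = Pu
walk-target R⇒P _  (step e p) = walk-target R⇒P (R⇒P e) p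

-- The walks in `linked` stay inside `set`, so that `set` is itself connected, as `helly` requires.
record Reachable {n} (R : Fin n → Fin n → Bool) (a : Fin n) : Set where
  field
    set    : Fin n → Bool
    self   : set a ≡ true
    linked : ∀ v → set v ≡ true → Linked (λ x y → set x ≡ true × set y ≡ true × R x y ≡ true) a v
    closed : ∀ u v → set u ≡ true → R u v ≡ true → set v ≡ true

abstract
  reach : ∀ {n} (R : Fin n → Fin n → Bool) a → Reachable R a
  reach {n} R a = grow n (singleton a) (ℕ.m≤m+n n _) (dec-true (a ≟ a) refl)
                    λ v v≡a → subst (Linked _ a) (sym (does⇒ (v ≟ a) v≡a)) linked-refl
    where
    LinkedIn : (Fin n → Bool) → Fin n → Set
    LinkedIn f = Linked (λ x y → f x ≡ true × f y ≡ true × R x y ≡ true) a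

    -- Each round adds one vertex. The invariant `n ≤ k + count f` ensures that `f` contains every
    -- vertex once `k` is zero.
    grow : ∀ k f → n ≤ k + count f → f a ≡ true → (∀ v → f v ≡ true → LinkedIn f v) → Reachable R a
    grow k f enough fa linked
      with any? (λ v → (f v Bool.≟ false) ×-dec any? (λ u → (f u Bool.≟ true) ×-dec (R u v Bool.≟ true)))
    ... | no none = record
      { set = f ; self = fa ; linked = linked
      ; closed = λ u v fu Ruv → Bool.¬-not λ fv≡f → none (v , fv≡f , u , fu , Ruv) }
    grow zero f enough fa linked | yes (v , ¬fv , _) = contradiction enough (ℕ.<⇒≱ (count<n v ¬fv))
    grow (suc k) f enough fa linked | yes (v , ¬fv , u , fu , Ruv) =
      grow k f⁺ (ℕ.≤-trans enough (ℕ.≤-trans (ℕ.≤-reflexive (sym (ℕ.+-suc k _)))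
        (ℕ.+-monoʳ-≤ k (count-⊂ v f⊑f⁺ ¬fv f⁺v)))) (f⊑f⁺ a fa) linked⁺
      where
      f⁺ : Fin n → Bool
      f⁺ x = singleton v x ∨ f x
      f⊑f⁺ : f ⊑ f⁺
      f⊑f⁺ x fx rewrite fx = Bool.∨-zeroʳ (singleton v x)
      f⁺v : f⁺ v ≡ true
      f⁺v rewrite dec-true (v ≟ v) refl = refl
      linked⁺ : ∀ x → f⁺ x ≡ true → LinkedIn f⁺ x
      linked⁺ x f⁺x with x ≟ v
      ... | no _ = linked-map (λ { (p , q , r) → f⊑f⁺ _ p , f⊑f⁺ _ q , r }) (linked x f⁺x)
      ... | yes refl = linked-snoc (linked-map (λ { (p , q , r) → f⊑f⁺ _ p , f⊑f⁺ _ q , r }) (linked u fu))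
                         (f⊑f⁺ u fu , f⁺v , Ruv)

_∖_ : ∀ {n} → (Fin n → Bool) → (Fin n → Bool) → Fin n → Bool
(W ∖ Q) x = W x ∧ not (Q x)

∖⇒ : ∀ {n} (W Q : Fin n → Bool) {x} → (W ∖ Q) x ≡ true → W x ≡ true × Q x ≡ false
∖⇒ W Q {x} i with W x | Q x
... | true | false = refl , refl

⇒∖ : ∀ {n} {W Q : Fin n → Bool} {x} → W x ≡ true → Q x ≡ false → (W ∖ Q) x ≡ true
⇒∖ Wx ¬Qx rewrite Wx | ¬Qx = refl

component : ∀ {n} (e : Fin n → Fin n → Bool) (M : Fin n → Bool) (a : Fin n) → Reachable (inside M e) a
component e M = reach (inside M e)

-- `Q` may reach outside `W`, so that a whole bag can be tested as a separator.
Balanced : ∀ {n} → (Fin n → Fin n → Bool) → (Fin n → Bool) → (Fin n → Bool) → Set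
Balanced e W Q = ∀ a → (W ∖ Q) a ≡ true → 2 * count (Reachable.set (component e (W ∖ Q) a)) ≤ count W

balanced? : ∀ {n} e W Q → Dec (Balanced {n} e W Q)
balanced? e W Q = all? λ a → ((W ∖ Q) a Bool.≟ true) →-dec (_ ≤? _)

component-⊑ : ∀ {n} e (M : Fin n → Bool) {a} → M a ≡ true → Reachable.set (component e M a) ⊑ M
component-⊑ e M {a} Ma v a~v = walk-target {P = λ x → M x ≡ true}
  (λ { (_ , _ , r) → proj₁ (proj₂ (inside⇒ M e r)) }) Ma
  (proj₂ (Reachable.linked (component e M a) v a~v))

common-element : ∀ {n} {f g h : Fin n → Bool} → f ⊑ h → g ⊑ h → count h < count f + count g →
          ∃ λ u → f u ≡ true × g u ≡ true
common-element {f = f} {g} f⊑h g⊑h h<f+g with any? (λ u → (f u Bool.≟ true) ×-dec (g u Bool.≟ true))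
... | yes found = found
... | no none = contradiction (count-disjoint f⊑h g⊑h λ u fu gu → none (u , fu , gu)) (ℕ.<⇒≱ h<f+g)

majorities : ∀ w x y → w < 2 * x → w < 2 * y → w < x + y
majorities w x y w<2x w<2y = ℕ.*-cancelˡ-< 2 w (x + y) (begin-strict
  2 * w         ≡⟨ cong (w +_) (ℕ.+-identityʳ w) ⟩
  w + w         <⟨ ℕ.+-mono-< w<2x w<2y ⟩
  2 * x + 2 * y ≡⟨ ℕ.*-distribˡ-+ 2 x y ⟨
  2 * (x + y)   ∎)
  where open ℕ.≤-Reasoning

abstract
  -- An exhaustive search through all vertex sets, which costs no query. The search terminates
  -- because the set of all vertices is balanced. Minimality transfers the size bound of an unknown
  -- balanced bag to the chosen set.
  minimumBalanced : ∀ {n} (e : Fin n → Fin n → Bool) (W : Fin n → Bool) →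
    ∃ λ (Q : Fin n → Bool) → Balanced e W Q ×
      (∀ (Q′ : Subset n) → Balanced e W (lookup Q′) → count Q ≤ count (lookup Q′))
  minimumBalanced {n} e W
    with least (λ k → anySubset? λ Q → (count (lookup Q) ≤? k) ×-dec balanced? e W (lookup Q))
               n (⊤ , count≤n _ , λ a a∈ →
                  contradiction (proj₂ (∖⇒ W (lookup ⊤) {a} a∈)) (true≢false (lookup-replicate a true)))
  ... | k , (Q , Q≤k , bal) , min = lookup Q , bal , λ Q′ bal′ → ℕ.≤-trans Q≤k (min _ (Q′ , ℕ.≤-refl , bal′))

module _ {n} {G : Graph n} (TD : TreeDecomposition G) where
  open Helly TD

  bagSet : Fin (m TD) → Subset n
  bagSet t = tabulate (bag TD t)

  -- If no bag were balanced, each would leave a component with more than half of W; these pairwise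
  -- intersect, so some bag would hit all of them, its own component included.
  balanced-bag : (e : Fin n → Fin n → Bool) (W : Fin n → Bool) →
                 (∀ x y → W x ≡ true → W y ≡ true → e x y ≡ true → Edge G x y) →
                 Fin n → ∃ λ t → Balanced e W (lookup (bagSet t))
  balanced-bag e W sound v₀ = decidable-stable (any? λ t → balanced? e W (lookup (bagSet t))) λ none →
    unbalanced λ t bal → none (t , bal)
    where
    unbalanced : ¬ (∀ t → ¬ Balanced e W (lookup (bagSet t)))
    unbalanced none = let u , tu , Ctu = proj₂ hitter (proj₁ hitter) in
      true≢false (trans (lookup∘tabulate (bag TD (proj₁ hitter)) u) tu)
        (proj₂ (∖⇒ W (lookup (bagSet (proj₁ hitter))) (C⊑ (proj₁ hitter) u Ctu)))
      where
      M : Fin (m TD) → Fin n → Bool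
      M t = W ∖ lookup (bagSet t)

      Light : Fin (m TD) → Fin n → Set
      Light t a = M t a ≡ true → 2 * count (Reachable.set (component e (M t) a)) ≤ count W

      heavy : ∀ t → ∃ λ a → ¬ Light t a
      heavy t = ¬∀⟶∃¬ n (Light t) (λ a → (M t a Bool.≟ true) →-dec (_ ≤? _)) (none t)

      a : Fin (m TD) → Fin n
      a t = proj₁ (heavy t)

      Ma : ∀ t → M t (a t) ≡ true
      Ma t = decidable-stable (M t (a t) Bool.≟ true) λ ¬Ma → proj₂ (heavy t) λ Ma → contradiction Ma ¬Ma

      C : Fin (m TD) → Fin n → Bool
      C t = Reachable.set (component e (M t) (a t))

      C⊑ : ∀ t → C t ⊑ M t
      C⊑ t = component-⊑ e (M t) (Ma t)

      C⊑W : ∀ t → C t ⊑ W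
      C⊑W t u Ctu = proj₁ (∖⇒ W (lookup (bagSet _)) (C⊑ t u Ctu))

      big : ∀ t → count W < 2 * count (C t)
      big t = ℕ.≰⇒> λ small → proj₂ (heavy t) λ _ → small

      linked : ∀ t u → C t u ≡ true → Linked (InducedEdge G (λ z → C t z ≡ true)) (a t) u
      linked t u Ctu = linked-map (λ { (p , q , r) → p , q , sound _ _ (C⊑W t _ p) (C⊑W t _ q)
        (proj₂ (proj₂ (inside⇒ (M t) e r))) }) (Reachable.linked (component e (M t) (a t)) u Ctu)

      meet : ∀ s t → ∃ λ u → C s u ≡ true × C t u ≡ true
      meet s t = common-element (C⊑W s) (C⊑W t) (majorities (count W) (count (C s)) (count (C t)) (big s) (big t))

      hitter : ∃ λ t → ∀ s → Hits (C s) t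
      hitter = helly C a linked meet (proj₁ (covers TD v₀))

-- Consequences of bounded degree and bounded treelength

neighbours : ∀ {n} (G : Graph n) v → count (adj G v) ≤ maxDegree G
neighbours G v = maxOver-upper (degree G) v

module Balls {n} (G : Graph n) (D : Fin n → Fin n → ℕ) (isD : IsDistOracle G D) where
  open Metric G D isD

  ball : Fin n → ℕ → Fin n → Bool
  ball u k x = does (D u x ≤? k)

  private
    Δ : ℕ
    Δ = maxDegree G

  ball-zero : ∀ u → count (ball u 0) ≤ 1
  ball-zero u = count-unique λ x y x∈ y∈ → trans (sym (centre x x∈)) (centre y y∈)
    where
    centre : ∀ x → ball u 0 x ≡ true → u ≡ x
    centre x x∈ = D≡0⇒≡ (ℕ.n≤0⇒n≡0 (does⇒ (D u x ≤? 0) x∈))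

  -- Each vertex of the larger ball is the centre or adjacent to a vertex of the smaller ball.
  ball-suc : ∀ u k → count (ball u (suc k)) ≤ 1 + count (ball u k) * Δ
  ball-suc u k = ℕ.≤-trans (count-∪ {g = ball u 0} {rest} split)
    (ℕ.+-mono-≤ (ball-zero u) (count-⋃ (ball u k) (adj G) covered (neighbours G)))
    where
    rest : Fin n → Bool
    rest x = does (any? λ w → (ball u k w Bool.≟ true) ×-dec (adj G w x Bool.≟ true))
    covered : ∀ x → rest x ≡ true → ∃ λ w → ball u k w ≡ true × adj G w x ≡ true
    covered x = does⇒ (any? _)
    split : ∀ x → ball u (suc k) x ≡ true → ball u 0 x ≡ true ⊎ rest x ≡ true
    split x x∈ = by-distance (D u x) refl
      where
      by-distance : ∀ d → D u x ≡ d → ball u 0 x ≡ true ⊎ rest x ≡ true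
      by-distance zero Dux = inj₁ (dec-true (D u x ≤? 0) (ℕ.≤-reflexive Dux))
      by-distance (suc d) Dux = let w , e , Duw = predecessor u x Dux in
        inj₂ (dec-true (any? _) (w , dec-true (D u w ≤? k) (ℕ.≤-trans (ℕ.≤-reflexive Duw)
          (ℕ.≤-pred (subst (_≤ suc k) Dux (does⇒ (D u x ≤? suc k) x∈)))) , e))

  matching : Δ ≤ 1 → ∀ {u v k} → Walk G u v k → u ≡ v ⊎ Edge G u v
  matching Δ≤1 here = inj₁ refl
  matching Δ≤1 (step {w = w} e p) with matching Δ≤1 p
  ... | inj₁ refl = inj₂ e
  ... | inj₂ e′   = inj₁ (count-unique⁻¹ (ℕ.≤-trans (neighbours G w) Δ≤1) (edge-sym G e) e′)

  -- Maximum degree one is treated apart, because there the recurrence of `ball-suc` grows with the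
  -- radius while the power of `Δ` does not; by `matching` such a ball has at most two vertices.
  ball-bound : 1 ≤ Δ → ∀ u k → count (ball u k) ≤ 2 * Δ ^ k
  ball-bound 1≤Δ u k with Δ in Δ≡
  ... | suc zero = begin
    count (ball u k)                       ≤⟨ count-∪ {g = ball u 0} {adj G u} split ⟩
    count (ball u 0) + count (adj G u)     ≤⟨ ℕ.+-mono-≤ (ball-zero u) (ℕ.≤-trans (neighbours G u) (ℕ.≤-reflexive Δ≡)) ⟩
    2                                      ≡⟨ cong (2 *_) (ℕ.^-zeroˡ k) ⟨
    2 * 1 ^ k                              ∎
    where
    open ℕ.≤-Reasoning
    split : ∀ x → ball u k x ≡ true → ball u 0 x ≡ true ⊎ adj G u x ≡ true
    split x _ with matching (ℕ.≤-reflexive Δ≡) (proj₁ (isD u x))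
    ... | inj₁ refl = inj₁ (dec-true (D u u ≤? 0) (ℕ.≤-reflexive (D-refl u)))
    ... | inj₂ e    = inj₂ e
  ... | suc (suc d) = ℕ.≤-trans (ℕ.n≤1+n _) (doubled k)
    where
    open ℕ.≤-Reasoning
    δ : ℕ
    δ = suc (suc d)
    -- The extra one makes the induction work: for `δ` at least two, `2 + b * δ` is at most
    -- `(1 + b) * δ`.
    doubled : ∀ k → suc (count (ball u k)) ≤ 2 * δ ^ k
    doubled zero = s≤s (ball-zero u)
    doubled (suc k) = begin
      suc (count (ball u (suc k))) ≤⟨ s≤s (ball-suc u k) ⟩
      2 + count (ball u k) * Δ     ≡⟨ cong (λ x → 2 + count (ball u k) * x) Δ≡ ⟩
      2 + count (ball u k) * δ     ≤⟨ ℕ.+-monoˡ-≤ _ (s≤s (s≤s z≤n)) ⟩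
      suc (count (ball u k)) * δ   ≤⟨ ℕ.*-monoˡ-≤ δ (doubled k) ⟩
      2 * δ ^ k * δ                ≡⟨ ℕ.*-assoc 2 (δ ^ k) δ ⟩
      2 * (δ ^ k * δ)              ≡⟨ cong (2 *_) (ℕ.*-comm (δ ^ k) δ) ⟩
      2 * δ ^ suc k                ∎

module Treelength {n} (G : Graph n) (D : Fin n → Fin n → ℕ) (isD : IsDistOracle G D)
                  (TD : TreeDecomposition G) {τ : ℕ}
                  (bag≤τ : ∀ t u v → bag TD t u ≡ true → bag TD t v ≡ true → D u v ≤ τ) where
  open Metric G D isD
  open Balls G D isD
  open Helly TD

  bag-bound : 1 ≤ maxDegree G → ∀ t → count (bag TD t) ≤ 2 * maxDegree G ^ τ
  bag-bound 1≤Δ t with any? (λ u → bag TD t u Bool.≟ true)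
  ... | yes (u , tu) = ℕ.≤-trans (count-mono λ v tv → dec-true (D u v ≤? τ) (bag≤τ t u v tu tv)) (ball-bound 1≤Δ u τ)
  ... | no none = ℕ.≤-trans (ℕ.≤-reflexive (count-none λ u tu → none (u , tu))) z≤n

  module _ (r : Fin n) where

    Deep : ℕ → Fin n → Set
    Deep l z = l ≤ D r z

    -- A bag meeting a geodesic from r to u, a geodesic from r to v and the deep walk from u to v
    -- contains a vertex at depth at least l, so it meets the geodesics within distance τ of u and v.
    deep-linked⇒close : ∀ {l u v} → D r u ≡ l → D r v ≡ l → Linked (InducedEdge G (Deep l)) u v → D u v ≤ 3 * τ
    deep-linked⇒close {l} {u} {v} Dru Drv (_ , deep-walk) = close (helly C c linked meet zero)
      where
      deep : Fin n → Bool
      deep z = does (l ≤? D r z)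

      between : Fin n → Fin n → Bool
      between w z = does (D r z + D z w ℕ.≟ D r w)

      -- The component of `u` among the deep vertices stands in for the deep walk: it contains the
      -- walk and is a decidable connected set.
      valley : Reachable (inside deep (adj G)) u
      valley = component (adj G) deep u

      C : Fin 3 → Fin n → Bool
      C zero             = between u
      C (suc zero)       = between v
      C (suc (suc zero)) = Reachable.set valley

      c : Fin 3 → Fin n
      c zero             = r
      c (suc zero)       = r
      c (suc (suc zero)) = u

      root-between : ∀ w → between w r ≡ true
      root-between w = dec-true (_ ℕ.≟ _) (cong (_+ D r w) (D-refl r))

      end-between : ∀ w → between w w ≡ true
      end-between w = dec-true (_ ℕ.≟ _) (trans (cong (D r w +_) (D-refl w)) (ℕ.+-identityʳ _))

      between-linked′ : ∀ w z → between w z ≡ true → Linked (InducedEdge G (λ z → between w z ≡ true)) r z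
      between-linked′ w z btw = linked-map
        (λ { (p , q , e) → dec-true (_ ℕ.≟ _) p , dec-true (_ ℕ.≟ _) q , e })
        (between-linked r w z (does⇒ (D r z + D z w ℕ.≟ D r w) btw))

      linked : ∀ i z → C i z ≡ true → Linked (InducedEdge G (λ z → C i z ≡ true)) (c i) z
      linked zero             = between-linked′ u
      linked (suc zero)       = between-linked′ v
      linked (suc (suc zero)) z z∈ = linked-map
        (λ { (p , q , e) → p , q , proj₂ (proj₂ (inside⇒ deep (adj G) e)) }) (Reachable.linked valley z z∈)

      valley-walk : ∀ {x y k} → Reachable.set valley x ≡ true → WalkR (InducedEdge G (Deep l)) x y k →
                    Reachable.set valley y ≡ true
      valley-walk x∈ here = x∈
      valley-walk x∈ (step (x↓ , w↓ , e) p) =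
        valley-walk (Reachable.closed valley _ _ x∈ (⇒∧ (dec-true (l ≤? _) x↓) (⇒∧ (dec-true (l ≤? _) w↓) e))) p

      v∈valley : Reachable.set valley v ≡ true
      v∈valley = valley-walk (Reachable.self valley) deep-walk

      meet : ∀ i j → ∃ λ z → C i z ≡ true × C j z ≡ true
      meet zero             zero             = r , root-between u , root-between u
      meet zero             (suc zero)       = r , root-between u , root-between v
      meet zero             (suc (suc zero)) = u , end-between u , Reachable.self valley
      meet (suc zero)       zero             = r , root-between v , root-between u
      meet (suc zero)       (suc zero)       = r , root-between v , root-between v
      meet (suc zero)       (suc (suc zero)) = v , end-between v , v∈valley
      meet (suc (suc zero)) zero             = u , Reachable.self valley , end-between u
      meet (suc (suc zero)) (suc zero)       = v , v∈valley , end-between v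
      meet (suc (suc zero)) (suc (suc zero)) = u , Reachable.self valley , Reachable.self valley

      near : ∀ {t w x q} → D r w ≡ l → bag TD t x ≡ true → between w x ≡ true → bag TD t q ≡ true →
             Reachable.set valley q ≡ true → D x w ≤ τ
      near {t} {w} {x} {q} Drw tx btw tq q∈ = ℕ.+-cancelˡ-≤ (D r x) (D x w) τ (begin
        D r x + D x w ≡⟨ does⇒ (D r x + D x w ℕ.≟ D r w) btw ⟩
        D r w         ≡⟨ Drw ⟩
        l             ≤⟨ does⇒ (l ≤? D r q) (component-⊑ (adj G) deep u-deep q q∈) ⟩
        D r q         ≤⟨ D-triangle r x q ⟩
        D r x + D x q ≤⟨ ℕ.+-monoʳ-≤ (D r x) (bag≤τ t x q tx tq) ⟩
        D r x + τ     ∎)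
        where
        open ℕ.≤-Reasoning
        u-deep : deep u ≡ true
        u-deep = dec-true (l ≤? D r u) (ℕ.≤-reflexive (sym Dru))

      close : (∃ λ t → ∀ i → Hits (C i) t) → D u v ≤ 3 * τ
      close (t , hit) = let x , tx , x∈ = hit zero
                            y , ty , y∈ = hit (suc zero)
                            q , tq , q∈ = hit (suc (suc zero)) in begin
        -- The three summands: from `u` to a bag vertex `x` on a geodesic to `u`, across the bag to
        -- a vertex `y` on a geodesic to `v`, and from `y` to `v`.
        D u v                   ≤⟨ D-triangle u x v ⟩
        D u x + D x v           ≤⟨ ℕ.+-monoʳ-≤ (D u x) (D-triangle x y v) ⟩
        D u x + (D x y + D y v) ≤⟨ ℕ.+-mono-≤ (ℕ.≤-trans (ℕ.≤-reflexive (D-sym u x)) (near Dru tx x∈ tq q∈))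
                                     (ℕ.+-mono-≤ (bag≤τ t x y tx ty) (near Drv ty y∈ tq q∈)) ⟩
        τ + (τ + τ)             ≡⟨ cong (λ z → τ + (τ + z)) (ℕ.+-identityʳ τ) ⟨
        3 * τ                   ∎
        where open ℕ.≤-Reasoning

-- Query programs

-- `QueryTree` with results of any type, so that the stages of the algorithm can be composed.
data Program (n : ℕ) (A : Set) : Set where
  ret   : A → Program n A
  query : Fin n → Fin n → (ℕ → Program n A) → Program n A

infixl 1 _>>=_

_>>=_ : ∀ {n A B} → Program n A → (A → Program n B) → Program n B
ret a       >>= f = f a
query u v k >>= f = query u v λ d → k d >>= f

toQueryTree : ∀ {n} → Program n (Fin n → Fin n → Bool) → QueryTree n
toQueryTree (ret E)       = done E
toQueryTree (query u v k) = ask u v λ d → toQueryTree (k d)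

-- Indices outside `f` receive `default` at no cost; `ensures-forEach` promises something only for
-- indices in `f`.
forEach : ∀ {m n A} → (Fin m → Bool) → (Fin m → A) → (Fin m → Program n A) → Program n (Fin m → A)
forEach {zero}  f default p = ret default
forEach {suc m} f default p =
  (if f zero then p zero else ret (default zero)) >>= λ a →
  forEach (f ∘ suc) (default ∘ suc) (p ∘ suc) >>= λ g →
  ret (a ∷ g)

askAll : ∀ {n} → (Fin n → Bool) → Fin n → Program n (Fin n → ℕ)
askAll f v = forEach f (λ _ → 0) λ x → query x v ret

module Semantics {n} (D : Fin n → Fin n → ℕ) where

  value : ∀ {A} → Program n A → A
  value (ret a)       = a
  value (query u v k) = value (k (D u v))

  cost : ∀ {A} → Program n A → ℕ
  cost (ret a)       = 0
  cost (query u v k) = suc (cost (k (D u v)))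

  run-value : ∀ p → proj₁ (run (toQueryTree p) D) ≡ value p
  run-value (ret E)       = refl
  run-value (query u v k) = run-value (k (D u v))

  run-cost : ∀ p → proj₂ (run (toQueryTree p) D) ≡ cost p
  run-cost (ret E)       = refl
  run-cost (query u v k) = cong suc (run-cost (k (D u v)))

  infix 0 _within_ensures_

  -- A Hoare-style judgement relative to the oracle `D`. Since `ensures->>=` passes on only the
  -- postcondition, cost and correctness are proved together, stage by stage.
  record _within_ensures_ {A : Set} (p : Program n A) (c : ℕ) (Φ : A → Set) : Set where
    constructor ensured
    field
      holds   : Φ (value p)
      bounded : cost p ≤ c

  value->>= : ∀ {A B} (p : Program n A) (f : A → Program n B) → value (p >>= f) ≡ value (f (value p))
  value->>= (ret a)       f = refl
  value->>= (query u v k) f = value->>= (k (D u v)) f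

  cost->>= : ∀ {A B} (p : Program n A) (f : A → Program n B) → cost (p >>= f) ≡ cost p + cost (f (value p))
  cost->>= (ret a)       f = refl
  cost->>= (query u v k) f = cong suc (cost->>= (k (D u v)) f)

  ensures-ret : ∀ {A} {a : A} {c} {Φ : A → Set} → Φ a → ret a within c ensures Φ
  ensures-ret Φa = ensured Φa z≤n

  ensures->>= : ∀ {A B} {p : Program n A} {f : A → Program n B} {c d} {Φ : A → Set} {Ψ : B → Set} →
    p within c ensures Φ → (∀ a → Φ a → f a within d ensures Ψ) → (p >>= f) within c + d ensures Ψ
  ensures->>= {p = p} {f} {Ψ = Ψ} (ensured Φa p≤c) f-ok with f-ok (value p) Φa
  ... | ensured Ψb f≤d = ensured (subst Ψ (sym (value->>= p f)) Ψb)
    (ℕ.≤-trans (ℕ.≤-reflexive (cost->>= p f)) (ℕ.+-mono-≤ p≤c f≤d))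

  ensures-≤ : ∀ {A} {p : Program n A} {c d} {Φ : A → Set} → c ≤ d → p within c ensures Φ → p within d ensures Φ
  ensures-≤ c≤d (ensured Φa p≤c) = ensured Φa (ℕ.≤-trans p≤c c≤d)

  ensures-map : ∀ {A} {p : Program n A} {c} {Φ Ψ : A → Set} → (∀ {a} → Φ a → Ψ a) →
                p within c ensures Φ → p within c ensures Ψ
  ensures-map Φ⇒Ψ (ensured Φa p≤c) = ensured (Φ⇒Ψ Φa) p≤c

  ensures-forEach : ∀ {m A c} {Φ : Fin m → A → Set} (f : Fin m → Bool) {default : Fin m → A}
    {p : Fin m → Program n A} → (∀ i → f i ≡ true → p i within c ensures Φ i) →
    forEach f default p within count f * c ensures λ g → ∀ i → f i ≡ true → Φ i (g i)
  ensures-forEach {zero} f p-ok = ensures-ret λ ()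
  ensures-forEach {suc m} {A} {c} {Φ} f {default} {p} p-ok =
    ensures-≤ cost-bound (ensures->>= first λ a Φa →
      ensures->>= (ensures-forEach {Φ = Φ ∘ suc} (f ∘ suc) (p-ok ∘ suc)) λ g Φg →
      ensures-ret λ { zero f₀ → Φa f₀ ; (suc i) fi → Φg i fi })
    where
    first : (if f zero then p zero else ret (default zero)) within bit (f zero) * c
            ensures λ a → f zero ≡ true → Φ zero a
    first with f zero | p-ok zero
    ... | true  | ok = ensures-≤ (ℕ.≤-reflexive (sym (ℕ.*-identityˡ c))) (ensures-map (λ Φa _ → Φa) (ok refl))
    ... | false | _  = ensures-ret λ ()
    cost-bound : bit (f zero) * c + (count (f ∘ suc) * c + 0) ≤ count f * c
    cost-bound = ℕ.≤-reflexive (trans (cong (bit (f zero) * c +_) (ℕ.+-identityʳ _))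
                                 (sym (ℕ.*-distribʳ-+ c (bit (f zero)) _)))

  ensures-askAll : ∀ f v → askAll f v within count f ensures λ g → ∀ x → f x ≡ true → g x ≡ D x v
  ensures-askAll f v = ensures-≤ (ℕ.≤-reflexive (ℕ.*-identityʳ _))
    (ensures-forEach {Φ = λ x d → d ≡ D x v} f λ x _ → ensured refl ℕ.≤-refl)

-- Searching for a parent

module Search {n} (e : Fin n → Fin n → Bool) (depth : Fin n → ℕ) (v : Fin n) where

  cut : (Fin n → Bool) → Fin n → Bool
  cut W = proj₁ (minimumBalanced e W)

  remainder : (Fin n → Bool) → Fin n → Fin n → Bool
  remainder W a = Reachable.set (component e (W ∖ cut W) a)

  -- `g x` is the answer for the distance from `x` to `v`, so the last equation places `x` on a
  -- geodesic from the root to `v`. The bound by `depth a` keeps to the ancestors whose descending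
  -- geodesics are known to stay in `W`.
  CutAncestor : Fin n → (Fin n → Bool) → (Fin n → ℕ) → Fin n → Set
  CutAncestor a W g x = cut W x ≡ true × W x ≡ true × depth a ≤ depth x × g x + depth x ≡ depth v

  cutAncestor? : ∀ a W g x → Dec (CutAncestor a W g x)
  cutAncestor? a W g x = (cut W x Bool.≟ true) ×-dec (W x Bool.≟ true) ×-dec (depth a ≤? depth x) ×-dec (_ ℕ.≟ _)

  ChildAncestor : Fin n → (Fin n → ℕ) → Fin n → Set
  ChildAncestor x h y = e x y ≡ true × depth y ≡ suc (depth x) × h y + depth y ≡ depth v

  childAncestor? : ∀ x h → Dec (∃ (ChildAncestor x h))
  childAncestor? x h = any? λ y → (e x y Bool.≟ true) ×-dec (_ ℕ.≟ _) ×-dec (_ ℕ.≟ _)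

  child : (Fin n → Program n (Fin n)) → ∀ x {h} → Dec (∃ (ChildAncestor x h)) → Program n (Fin n)
  child continue x (yes (y , _)) = continue y
  -- A default value: `child-correct` shows that the search for a child succeeds.
  child continue x (no _)        = ret x

  below : (Fin n → Program n (Fin n)) → ∀ x {d} → Dec (d ≡ 1) → Program n (Fin n)
  below continue x (yes _) = ret x
  below continue x (no _)  = askAll (e x) v >>= λ h → child continue x (childAncestor? x h)

  branch : (Fin n → Program n (Fin n)) → ∀ a W g →
           (∀ x → ¬ CutAncestor a W g x) ⊎
           (∃ λ x → CutAncestor a W g x × (∀ y → CutAncestor a W g y → depth y ≤ depth x)) →
           Program n (Fin n)
  branch continue a W g (inj₁ _)       = continue a
  branch continue a W g (inj₂ (x , _)) = below continue x (g x ℕ.≟ 1)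

  search : ℕ → Fin n → (Fin n → Bool) → Program n (Fin n)
  -- A default value: `W` contains `a`, which contradicts `count W < 2 ^ 0`.
  search zero       a W = ret a
  search (suc fuel) a W = askAll (cut W) v >>= λ g →
    branch (λ b → search fuel b (remainder W b)) a W g (argmax (cutAncestor? a W g) depth)

-- Correctness and cost of the parent search

module SearchCorrect {n} (G : Graph n) (D : Fin n → Fin n → ℕ) (isD : IsDistOracle G D) (r : Fin n)
  (e : Fin n → Fin n → Bool) (depth : Fin n → ℕ) (depth≡ : ∀ x → depth x ≡ D r x)
  (k : ℕ) (v : Fin n) (v-depth : depth v ≡ suc k)
  (e-sound : ∀ x y → e x y ≡ true → Edge G x y)
  (e-complete : ∀ x y → depth x ≤ k → depth y ≤ k → Edge G x y → e x y ≡ true)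
  {K : ℕ} (small-cuts : ∀ W → count (Search.cut e depth v W) ≤ K)
  where

  open Metric G D isD
  open Semantics D
  open Search e depth v

  private
    Δ : ℕ
    Δ = maxDegree G

  Ancestor : Fin n → Set
  Ancestor x = D x v + depth x ≡ depth v

  Parent : Fin n → Set
  Parent p = Edge G p v × suc (depth p) ≡ depth v

  depth-edge : ∀ {x y} → Edge G x y → depth y ≤ suc (depth x)
  depth-edge {x} {y} xy rewrite depth≡ x | depth≡ y = D-edge r xy

  depth-triangle : ∀ y → depth v ≤ D y v + depth y
  depth-triangle y rewrite depth≡ y | depth≡ v = ℕ.≤-trans (D-triangle r y v) (ℕ.≤-reflexive (ℕ.+-comm (D r y) _))

  -- The next vertex on a geodesic from `x` to `v` is one closer to `v`. Its depth is at most one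
  -- more than that of `x` by the edge, and at least one more by the triangle inequality through the
  -- root.
  child-ancestor : ∀ {x} → Ancestor x → depth x ≤ k → D x v ≢ 1 →
                   ∃ λ y → Edge G x y × depth y ≡ suc (depth x) × Ancestor y
  child-ancestor {x} anc x≤k Dxv≢1 = by-distance (D x v) refl
    where
    by-distance : ∀ d → D x v ≡ d → ∃ λ y → Edge G x y × depth y ≡ suc (depth x) × Ancestor y
    by-distance zero Dxv = contradiction (trans (cong (_+ depth x) (sym Dxv)) (trans anc v-depth))
                             (ℕ.<⇒≢ (s≤s x≤k))
    by-distance (suc d) Dxv with predecessor v x (trans (D-sym v x) Dxv)
    ... | y , yx , Dvy = y , edge-sym G yx , y-depth , (begin-equality
      D y v + depth y         ≡⟨ cong₂ _+_ Dyv y-depth ⟩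
      d + suc (depth x)       ≡⟨ ℕ.+-suc d (depth x) ⟩
      suc d + depth x         ≡⟨ cong (_+ depth x) Dxv ⟨
      D x v + depth x         ≡⟨ anc ⟩
      depth v                 ∎)
      where
      open ℕ.≤-Reasoning
      Dyv : D y v ≡ d
      Dyv = trans (D-sym y v) Dvy
      y-depth : depth y ≡ suc (depth x)
      y-depth = ℕ.≤-antisym (depth-edge (edge-sym G yx)) (ℕ.+-cancelˡ-≤ d (suc (depth x)) (depth y) (begin
        d + suc (depth x) ≡⟨ ℕ.+-suc d (depth x) ⟩
        suc d + depth x   ≡⟨ cong (_+ depth x) Dxv ⟨
        D x v + depth x   ≡⟨ anc ⟩
        depth v           ≤⟨ depth-triangle y ⟩
        D y v + depth y   ≡⟨ cong (_+ depth y) Dyv ⟩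
        d + depth y       ∎))

  -- The descending geodesics from any ancestor in W at least as deep as a stay in W until they reach v.
  record Valid (a : Fin n) (W : Fin n → Bool) : Set where
    field
      member   : W a ≡ true
      ancestor : Ancestor a
      shallow  : ∀ x → W x ≡ true → depth x ≤ k
      closed   : ∀ y z → W y ≡ true → Ancestor y → depth a ≤ depth y → Edge G y z → depth z ≡ suc (depth y) →
                 Ancestor z → depth z ≤ k → W z ≡ true
  open Valid

  -- By `clear`, the geodesics descending from `b` meet no vertex of the cut. `closed` keeps them in
  -- `W`, and their edges up to depth `k` are known by `e-complete`, so they stay in the component
  -- of `b`. Balance gives the halving.
  remainder-valid : ∀ {a W} → Valid a W → ∀ b → W b ≡ true → Ancestor b → depth a ≤ depth b →
    (∀ z → cut W z ≡ true → W z ≡ true → Ancestor z → depth b ≤ depth z → ⊥) →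
    Valid b (remainder W b) × 2 * count (remainder W b) ≤ count W
  remainder-valid {a} {W} valid b Wb anc a≤b clear = record
    { member   = Reachable.self comp
    ; ancestor = anc
    ; shallow  = λ x x∈ → shallow valid x (proj₁ (∖⇒ W (cut W) (C⊑M x x∈)))
    ; closed   = λ y z y∈ y-anc b≤y yz z≡ z-anc z≤k →
        let y∈M = C⊑M y y∈
            Wy  = proj₁ (∖⇒ W (cut W) y∈M)
            Wz  = closed valid y z Wy y-anc (ℕ.≤-trans a≤b b≤y) yz z≡ z-anc z≤k
            y<z = ℕ.≤-reflexive (sym z≡)
            z∈M = ⇒∖ {W = W} {cut W} Wz (Bool.¬-not λ Qz → clear z Qz Wz z-anc (ℕ.≤-trans b≤y (ℕ.<⇒≤ y<z)))
        in Reachable.closed comp y z y∈ (⇒∧ y∈M (⇒∧ z∈M (e-complete y z (shallow valid y Wy) z≤k yz)))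
    } , proj₁ (proj₂ (minimumBalanced e W)) b b∈M
    where
    M : Fin n → Bool
    M = W ∖ cut W
    comp : Reachable (inside M e) b
    comp = component e M b
    b∈M : M b ≡ true
    b∈M = ⇒∖ {W = W} {cut W} Wb (Bool.¬-not λ Qb → clear b Qb Wb anc ℕ.≤-refl)
    C⊑M : Reachable.set comp ⊑ M
    C⊑M = component-⊑ e M b∈M

  -- Each round halves `W` and asks at most `K` queries on the cut and `Δ` on the neighbours of its
  -- deepest ancestor of `v`.
  search-correct : ∀ fuel a W → Valid a W → count W < 2 ^ fuel →
                   search fuel a W within fuel * (K + Δ) ensures Parent
  search-correct zero a W valid W<1 =
    contradiction (count-positive a (member valid)) (ℕ.<⇒≱ W<1)
  search-correct (suc fuel) a W valid W<2^ =
    ensures-≤ (ℕ.≤-reflexive (sym (ℕ.+-assoc K Δ _)))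
      (ensures->>= (ensures-≤ (small-cuts W) (ensures-askAll (cut W) v)) λ g g≡ →
        branch-correct g g≡ (argmax (cutAncestor? a W g) depth))
    where
    continue : Fin n → Program n (Fin n)
    continue b = search fuel b (remainder W b)

    continue-correct : ∀ b → W b ≡ true → Ancestor b → depth a ≤ depth b →
      (∀ z → cut W z ≡ true → W z ≡ true → Ancestor z → depth b ≤ depth z → ⊥) →
      continue b within fuel * (K + Δ) ensures Parent
    continue-correct b Wb anc a≤b clear =
      let valid′ , half = remainder-valid valid b Wb anc a≤b clear in
      search-correct fuel b (remainder W b) valid′ (ℕ.*-cancelˡ-< 2 _ _ (ℕ.≤-<-trans half W<2^))

    below-correct : ∀ x → W x ≡ true → Ancestor x → depth a ≤ depth x →
      (∀ z → cut W z ≡ true → W z ≡ true → Ancestor z → depth z ≤ depth x) →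
      ∀ {d} → d ≡ D x v → (d≟1 : Dec (d ≡ 1)) → below continue x d≟1 within Δ + fuel * (K + Δ) ensures Parent
    below-correct x Wx anc a≤x deepest refl (yes Dxv≡1) =
      ensures-ret (D≡1⇒edge Dxv≡1 , trans (cong (_+ depth x) (sym Dxv≡1)) anc)
    below-correct x Wx anc a≤x deepest refl (no Dxv≢1) =
      ensures->>= (ensures-≤ (ℕ.≤-trans (count-mono (e-sound x)) (neighbours G x)) (ensures-askAll (e x) v))
        λ h h≡ → child-correct h h≡ (childAncestor? x h)
      where
      x≤k : depth x ≤ k
      x≤k = shallow valid x Wx

      -- If `y` were at distance zero from `v`, it would be `v` and `x` would be at distance one. So
      -- `y` lies strictly above `v`, in the known layers.
      inner : ∀ y → Edge G x y → Ancestor y → depth y ≤ k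
      inner y xy anc-y = ℕ.≤-pred (subst (suc (depth y) ≤_) (trans anc-y v-depth)
        (ℕ.+-monoˡ-≤ (depth y) (ℕ.n≢0⇒n>0 λ Dyv≡0 →
          Dxv≢1 (subst (λ z → D x z ≡ 1) (D≡0⇒≡ Dyv≡0) (edge⇒D≡1 xy)))))

      child-correct : ∀ h → (∀ y → e x y ≡ true → h y ≡ D y v) → (found? : Dec (∃ (ChildAncestor x h))) →
                      child continue x found? within fuel * (K + Δ) ensures Parent
      child-correct h h≡ (yes (y , exy , y-depth , hy)) =
        continue-correct y (closed valid x y Wx anc a≤x xy y-depth anc-y (inner y xy anc-y)) anc-y
          (ℕ.≤-trans a≤x (ℕ.<⇒≤ x<y))
          -- A cut ancestor at the depth of `y` or below would be deeper than `x`, the deepest one.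
          λ z Qz Wz anc-z y≤z → ℕ.<⇒≱ (ℕ.<-≤-trans x<y y≤z) (deepest z Qz Wz anc-z)
        where
        xy : Edge G x y
        xy = e-sound x y exy
        x<y : depth x < depth y
        x<y = ℕ.≤-reflexive (sym y-depth)
        anc-y : Ancestor y
        anc-y = trans (cong (_+ depth y) (sym (h≡ y exy))) hy
      child-correct h h≡ (no none) =
        let y , xy , y-depth , anc-y = child-ancestor anc x≤k Dxv≢1
            exy = e-complete x y x≤k (inner y xy anc-y) xy
        in contradiction (y , exy , y-depth , trans (cong (_+ depth y) (h≡ y exy)) anc-y) none

    branch-correct : ∀ g → (∀ x → cut W x ≡ true → g x ≡ D x v) → ∀ b →
                     branch continue a W g b within Δ + fuel * (K + Δ) ensures Parent
    branch-correct g g≡ (inj₁ none) = ensures-≤ (ℕ.m≤n+m _ Δ)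
      (continue-correct a (member valid) (ancestor valid) ℕ.≤-refl
        λ z Qz Wz anc-z a≤z → none z (Qz , Wz , a≤z , trans (cong (_+ depth z) (g≡ z Qz)) anc-z))
    branch-correct g g≡ (inj₂ (x , (Qx , Wx , a≤x , gx) , max)) =
      below-correct x Wx (trans (cong (_+ depth x) (sym (g≡ x Qx))) gx) a≤x deepest (g≡ x Qx) (g x ℕ.≟ 1)
      where
      deepest : ∀ z → cut W z ≡ true → W z ≡ true → Ancestor z → depth z ≤ depth x
      -- `max` speaks only of ancestors no shallower than `a`; all others are shallower than `a`,
      -- hence than `x`.
      deepest z Qz Wz anc-z with depth a ≤? depth z
      ... | yes a≤z = max z (Qz , Wz , a≤z , trans (cong (_+ depth z) (g≡ z Qz)) anc-z)
      ... | no a≰z = ℕ.≤-trans (ℕ.<⇒≤ (ℕ.≰⇒> a≰z)) a≤x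

-- Reconstruction layer by layer

-- cluster relates vertices of equal depth that may be joined by a walk at no smaller depth.
record Knowledge (n : ℕ) : Set where
  constructor knowledge
  field
    cluster : Fin n → Fin n → Bool
    edge    : Fin n → Fin n → Bool
open Knowledge

module Layering {n} (τ fuel : ℕ) (r : Fin n) (depth : Fin n → ℕ) where

  level : ℕ → Fin n → Bool
  level k v = does (depth v ℕ.≟ k)

  upTo : ℕ → Fin n → Bool
  upTo k v = does (depth v ≤? k)

  -- Only the root has depth zero, so this relates the root to itself.
  start : Knowledge n
  start = knowledge (λ u v → level 0 u ∧ level 0 v) (λ _ _ → false)

  sibling : (Fin n → Fin n → Bool) → (Fin n → Fin n) → Fin n → Fin n → Bool
  sibling R p v u = R (p u) (p v)

  -- The first alternative collects possible neighbours of `v` in the previous layer, the second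
  -- those in its own layer.
  candidates : ℕ → (Fin n → Fin n → Bool) → (Fin n → Fin n) → Fin n → Fin n → Bool
  candidates k R p v u = (level k u ∧ R u (p v)) ∨ (level (suc k) u ∧ sibling R p v u)

  module Extension (k : ℕ) (K : Knowledge n) (p : Fin n → Fin n) (g : Fin n → Fin n → ℕ) where

    found : Fin n → Fin n → Bool
    found v u = level (suc k) v ∧ (candidates k (cluster K) p v u ∧ does (g v u ℕ.≟ 1))

    -- Related parents alone would bound the distance only by `3 * τ + 2`. The test restores
    -- `3 * τ`, so the bound does not grow from layer to layer, and by `deep-linked⇒close` it
    -- rejects no pair that must be related.
    close : Fin n → Fin n → Bool
    close v u = level (suc k) v ∧ ((level (suc k) u ∧ sibling (cluster K) p v u) ∧ does (g v u ≤? 3 * τ))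

    extended : Knowledge n
    extended = knowledge (λ u v → cluster K u v ∨ close v u) (λ u v → edge K u v ∨ (found v u ∨ found u v))

  layer : ℕ → Knowledge n → Program n (Knowledge n)
  layer k K =
    forEach (level (suc k)) id (λ v → Search.search (edge K) depth v fuel r (upTo k)) >>= λ p →
    -- This is a second pass because `candidates` consults the parents of other vertices of the
    -- layer as well.
    forEach (level (suc k)) (λ _ _ → 0) (λ v → askAll (candidates k (cluster K) p v) v) >>= λ g →
    ret (Extension.extended k K p g)

  layers : ℕ → Program n (Knowledge n)
  layers zero    = ret start
  layers (suc k) = layers k >>= layer k

-- With fewer than two vertices the logarithm is zero and no query is allowed, but there is no edge
-- to find either.
reconstruct : ∀ n → ℕ → Program n (Fin n → Fin n → Bool)
reconstruct zero          τ = ret λ _ _ → false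
reconstruct (suc zero)    τ = ret λ _ _ → false
reconstruct (suc (suc n)) τ =
  askAll (λ _ → true) zero >>= λ depth →
  Layering.layers τ ⌈log₂ suc (suc n) ⌉ zero depth (maxOver depth) >>= λ K →
  ret (edge K)

∨⇒ : ∀ {a b} → a ∨ b ≡ true → a ≡ true ⊎ b ≡ true
∨⇒ {true}  _ = inj₁ refl
∨⇒ {false} b = inj₂ b

⇒∨ˡ : ∀ {a b} → a ≡ true → a ∨ b ≡ true
⇒∨ˡ refl = refl

⇒∨ʳ : ∀ a {b} → b ≡ true → a ∨ b ≡ true
⇒∨ʳ a refl = Bool.∨-zeroʳ a

-- Correctness and cost of the layered reconstruction

module LayeringCorrect {n} (G : Graph n) (D : Fin n → Fin n → ℕ) (isD : IsDistOracle G D)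
  (1≤Δ : 1 ≤ maxDegree G) (TD : TreeDecomposition G) {τ : ℕ}
  (bag≤τ : ∀ t u v → bag TD t u ≡ true → bag TD t v ≡ true → D u v ≤ τ)
  (fuel : ℕ) (n≤2^fuel : n ≤ 2 ^ fuel)
  (r : Fin n) (depth : Fin n → ℕ) (depth≡ : ∀ x → depth x ≡ D r x)
  where

  open Metric G D isD
  open Semantics D
  open Balls G D isD
  open Treelength G D isD TD bag≤τ
  open Layering τ fuel r depth

  private
    Δ : ℕ
    Δ = maxDegree G

  searchCost candidateCost : ℕ
  searchCost    = fuel * (2 * Δ ^ τ + Δ)
  candidateCost = 2 * Δ ^ (3 * τ) + 2 * Δ ^ (3 * τ) * Δ

  -- `cluster` is only pinned between two relations: it contains all pairs of equal depth that are
  -- linked at no smaller depth, and it is contained in the pairs at distance at most `3 * τ`. The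
  -- first yields completeness of the candidates, the second their number.
  record Correct (k : ℕ) (K : Knowledge n) : Set where
    field
      cluster-close    : ∀ u v → cluster K u v ≡ true → D u v ≤ 3 * τ
      cluster-complete : ∀ l u v → l ≤ k → depth u ≡ l → depth v ≡ l → Linked (InducedEdge G (Deep r l)) u v →
                         cluster K u v ≡ true
      edge-sound       : ∀ u v → edge K u v ≡ true → Edge G u v
      edge-complete    : ∀ u v → depth u ≤ k → depth v ≤ k → Edge G u v → edge K u v ≡ true
  open Correct

  level⇒ : ∀ {k v} → level k v ≡ true → depth v ≡ k
  level⇒ {k} {v} = does⇒ (depth v ℕ.≟ k)

  ⇒level : ∀ {k v} → depth v ≡ k → level k v ≡ true
  ⇒level {k} {v} = dec-true (depth v ℕ.≟ k)

  deep : ∀ {l v} → l ≤ depth v → Deep r l v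
  deep {l} {v} = subst (l ≤_) (depth≡ v)

  depth≡0⇒root : ∀ {v} → depth v ≡ 0 → v ≡ r
  depth≡0⇒root {v} v≡0 = sym (D≡0⇒≡ (trans (sym (depth≡ v)) v≡0))

  start-correct : Correct 0 start
  start-correct = record
    { cluster-close    = λ u v c → let u₀ , v₀ = ∧⇒ c in
        ℕ.≤-trans (ℕ.≤-reflexive (trans
          (cong₂ D (depth≡0⇒root (level⇒ u₀)) (depth≡0⇒root (level⇒ v₀))) (D-refl r))) z≤n
    ; cluster-complete = λ { _ u v z≤n u₀ v₀ _ → ⇒∧ (⇒level u₀) (⇒level v₀) }
    ; edge-sound       = λ _ _ ()
    ; edge-complete    = λ u v u≤0 v≤0 e → contradiction (Graph.irrefl G r) (true≢false
        (subst (λ x → Edge G x r) (depth≡0⇒root (ℕ.n≤0⇒n≡0 u≤0))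
          (subst (Edge G u) (depth≡0⇒root (ℕ.n≤0⇒n≡0 v≤0)) e)))
    }

  -- Some bag is balanced for the known graph, and the minimum cut is no larger than that bag.
  small-cuts : ∀ {e} → (∀ u v → e u v ≡ true → Edge G u v) → ∀ v W → count (Search.cut e depth v W) ≤ 2 * Δ ^ τ
  small-cuts {e} sound v W =
    let t , balanced = balanced-bag TD e W (λ x y _ _ → sound x y) v in begin
    count (Search.cut e depth v W) ≤⟨ proj₂ (proj₂ (minimumBalanced e W)) (bagSet TD t) balanced ⟩
    count (lookup (bagSet TD t))   ≤⟨ count-mono (λ x x∈ → trans (sym (lookup∘tabulate (bag TD t) x)) x∈) ⟩
    count (bag TD t)               ≤⟨ bag-bound 1≤Δ t ⟩
    2 * Δ ^ τ                      ∎
    where open ℕ.≤-Reasoning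

  Parent : Fin n → Fin n → Set
  Parent v p = Edge G p v × suc (depth p) ≡ depth v

  parent-found : ∀ {k K} → Correct k K → ∀ v → level (suc k) v ≡ true →
    Search.search (edge K) depth v fuel r (upTo k) within searchCost ensures Parent v
  parent-found {k} {K} ok v v∈ = search-correct fuel r (upTo k)
    (record
      { member   = dec-true (depth r ≤? k) (ℕ.≤-trans (ℕ.≤-reflexive (trans (depth≡ r) (D-refl r))) z≤n)
      ; ancestor = trans (cong₂ _+_ (sym (depth≡ v)) (trans (depth≡ r) (D-refl r))) (ℕ.+-identityʳ _)
      ; shallow  = λ x → does⇒ (depth x ≤? k)
      ; closed   = λ _ z _ _ _ _ _ _ z≤k → dec-true (depth z ≤? k) z≤k
      })
    -- `v` is missing from `upTo k`, which gives the strict inequality that the fuel invariant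
    -- needs.
    (ℕ.<-≤-trans (count<n v (dec-false (depth v ≤? k) (ℕ.<⇒≱ (ℕ.≤-reflexive (sym (level⇒ v∈)))))) n≤2^fuel)
    where
    open SearchCorrect G D isD r (edge K) depth depth≡ k v (level⇒ v∈)
      (edge-sound ok) (edge-complete ok) (small-cuts (edge-sound ok) v)

  module Step {k : ℕ} {K : Knowledge n} (ok : Correct k K) {p : Fin n → Fin n}
              (parent : ∀ v → level (suc k) v ≡ true → Parent v (p v)) where

    parent-level : ∀ {v} → depth v ≡ suc k → depth (p v) ≡ k
    parent-level v≡ = ℕ.suc-injective (trans (proj₂ (parent _ (⇒level v≡))) v≡)

    parent-edge : ∀ {v} → depth v ≡ suc k → Edge G (p v) v
    parent-edge v≡ = proj₁ (parent _ (⇒level v≡))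

    -- Candidates of the previous layer lie in the ball of radius `3 * τ` around `p v`; those of the
    -- own layer are neighbours of vertices in that ball, namely of their parents.
    candidates-few : ∀ v → count (candidates k (cluster K) p v) ≤ candidateCost
    candidates-few v = ℕ.≤-trans (count-∪ {g = near} {siblings} split)
      (ℕ.+-mono-≤ near-few (ℕ.≤-trans (count-⋃ near (adj G) via-parent (neighbours G)) (ℕ.*-monoˡ-≤ Δ near-few)))
      where
      near : Fin n → Bool
      near u = cluster K u (p v)
      siblings : Fin n → Bool
      siblings u = level (suc k) u ∧ sibling (cluster K) p v u
      via-parent : ∀ u → siblings u ≡ true → ∃ λ w → near w ≡ true × adj G w u ≡ true
      via-parent u u∈ = let u≡ , s = ∧⇒ u∈ in p u , s , parent-edge (level⇒ u≡)
      near-few : count near ≤ 2 * Δ ^ (3 * τ)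
      near-few = ℕ.≤-trans (count-mono λ u u∈ → dec-true (D (p v) u ≤? 3 * τ)
        (ℕ.≤-trans (ℕ.≤-reflexive (D-sym (p v) u)) (cluster-close ok u (p v) u∈))) (ball-bound 1≤Δ (p v) (3 * τ))
      split : ∀ u → candidates k (cluster K) p v u ≡ true → near u ≡ true ⊎ siblings u ≡ true
      split u c with ∨⇒ c
      ... | inj₁ c′ = inj₁ (proj₂ (∧⇒ {level k u} c′))
      ... | inj₂ c′ = inj₂ c′

    -- Adding the two parent edges at the ends turns the walk into one from `p u` to `p v` at depth
    -- at least `k`.
    sibling-complete : ∀ {u v} → depth u ≡ suc k → depth v ≡ suc k → Linked (InducedEdge G (Deep r (suc k))) u v →
                       sibling (cluster K) p v u ≡ true
    sibling-complete {u} {v} u≡ v≡ u~v = cluster-complete ok k (p u) (p v) ℕ.≤-refl (parent-level u≡) (parent-level v≡)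
      (linked-trans (_ , step (deepₚ u≡ , deepₛ u≡ , parent-edge u≡) here)
        (linked-snoc (linked-map (λ { (a , b , e) → ℕ.<⇒≤ a , ℕ.<⇒≤ b , e }) u~v)
          (deepₛ v≡ , deepₚ v≡ , edge-sym G (parent-edge v≡))))
      where
      deepₚ : ∀ {w} → depth w ≡ suc k → Deep r k (p w)
      deepₚ w≡ = deep (ℕ.≤-reflexive (sym (parent-level w≡)))
      deepₛ : ∀ {w} → depth w ≡ suc k → Deep r k w
      deepₛ w≡ = deep (ℕ.≤-trans (ℕ.n≤1+n k) (ℕ.≤-reflexive (sym w≡)))

    -- An edge inside the new layer is itself a deep walk. If `u` lies in the previous layer, the
    -- walk from `u` over `v` to `p v` stays at depth at least `k` and relates `u` to `p v`.
    candidates-complete : ∀ {u v} → depth v ≡ suc k → depth u ≤ suc k → Edge G u v →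
                          candidates k (cluster K) p v u ≡ true
    candidates-complete {u} {v} v≡ u≤ e with ℕ.m≤n⇒m<n∨m≡n u≤
    ... | inj₂ u≡ = ⇒∨ʳ (level k u ∧ cluster K u (p v)) (⇒∧ (⇒level u≡)
      (sibling-complete u≡ v≡ (_ , step (deep (ℕ.≤-reflexive (sym u≡)) , deep (ℕ.≤-reflexive (sym v≡)) , e) here)))
    ... | inj₁ u<1+k = ⇒∨ˡ (⇒∧ (⇒level u≡k) (cluster-complete ok k u (p v) ℕ.≤-refl u≡k (parent-level v≡)
        (_ , step (deepᵤ , deepᵥ , e) (step (deepᵥ , deepₚ , edge-sym G (parent-edge v≡)) here))))
      where
      u≡k : depth u ≡ k
      u≡k = ℕ.≤-antisym (ℕ.≤-pred u<1+k) (ℕ.≤-pred (subst (_≤ suc (depth u)) v≡ v≤1+u))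
        where
        v≤1+u : depth v ≤ suc (depth u)
        v≤1+u rewrite depth≡ u | depth≡ v = D-edge r e
      deepᵤ : Deep r k u
      deepᵤ = deep (ℕ.≤-reflexive (sym u≡k))
      deepᵥ : Deep r k v
      deepᵥ = deep (ℕ.≤-trans (ℕ.n≤1+n k) (ℕ.≤-reflexive (sym v≡)))
      deepₚ : Deep r k (p v)
      deepₚ = deep (ℕ.≤-reflexive (sym (parent-level v≡)))

    module _ {g : Fin n → Fin n → ℕ}
             (g≡ : ∀ v → level (suc k) v ≡ true → ∀ u → candidates k (cluster K) p v u ≡ true → g v u ≡ D u v) where
      open Extension k K p g

      found-sound : ∀ v u → found v u ≡ true → Edge G u v
      found-sound v u f =
        let v∈ , f′ = ∧⇒ f
            c , gvu = ∧⇒ {candidates k (cluster K) p v u} f′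
        in D≡1⇒edge (trans (sym (g≡ v v∈ u c)) (does⇒ (g v u ℕ.≟ 1) gvu))

      found-complete : ∀ v u → depth v ≡ suc k → depth u ≤ suc k → Edge G u v → found v u ≡ true
      found-complete v u v≡ u≤ e =
        let c = candidates-complete v≡ u≤ e in
        ⇒∧ (⇒level v≡) (⇒∧ c (dec-true (g v u ℕ.≟ 1) (trans (g≡ v (⇒level v≡) u c) (edge⇒D≡1 e))))

      close-sound : ∀ v u → close v u ≡ true → D u v ≤ 3 * τ
      close-sound v u c =
        let v∈ , c′  = ∧⇒ c
            s , g≤3τ = ∧⇒ {level (suc k) u ∧ sibling (cluster K) p v u} c′
        in subst (_≤ 3 * τ) (g≡ v v∈ u (⇒∨ʳ (level k u ∧ cluster K u (p v)) s)) (does⇒ (g v u ≤? 3 * τ) g≤3τ)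

      close-complete : ∀ v u → depth v ≡ suc k → depth u ≡ suc k → Linked (InducedEdge G (Deep r (suc k))) u v →
                       close v u ≡ true
      close-complete v u v≡ u≡ u~v =
        let s = ⇒∧ (⇒level u≡) (sibling-complete u≡ v≡ u~v) in
        ⇒∧ (⇒level v≡) (⇒∧ s (dec-true (g v u ≤? 3 * τ) (ℕ.≤-trans
          (ℕ.≤-reflexive (g≡ v (⇒level v≡) u (⇒∨ʳ (level k u ∧ cluster K u (p v)) s)))
          (deep-linked⇒close r (trans (sym (depth≡ u)) u≡) (trans (sym (depth≡ v)) v≡) u~v))))

      extended-correct : Correct (suc k) extended
      extended-correct = record
        { cluster-close = λ u v c → [ cluster-close ok u v , close-sound v u ]′ (∨⇒ c)
        ; cluster-complete = complete
        ; edge-sound = λ u v e →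
            [ edge-sound ok u v , [ found-sound v u , edge-sym G ∘ found-sound u v ]′ ∘ ∨⇒ ]′ (∨⇒ {edge K u v} e)
        ; edge-complete = edges-complete
        }
        where
        complete : ∀ l u v → l ≤ suc k → depth u ≡ l → depth v ≡ l → Linked (InducedEdge G (Deep r l)) u v →
                   cluster extended u v ≡ true
        complete l u v l≤ u≡ v≡ u~v with ℕ.m≤n⇒m<n∨m≡n l≤
        ... | inj₁ l<1+k = ⇒∨ˡ (cluster-complete ok l u v (ℕ.≤-pred l<1+k) u≡ v≡ u~v)
        ... | inj₂ refl = ⇒∨ʳ (cluster K u v) (close-complete v u v≡ u≡ u~v)

        edges-complete : ∀ u v → depth u ≤ suc k → depth v ≤ suc k → Edge G u v → edge extended u v ≡ true
        edges-complete u v u≤ v≤ e with ℕ.m≤n⇒m<n∨m≡n u≤ | ℕ.m≤n⇒m<n∨m≡n v≤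
        ... | _ | inj₂ v≡ = ⇒∨ʳ (edge K u v) (⇒∨ˡ (found-complete v u v≡ u≤ e))
        ... | inj₂ u≡ | _ = ⇒∨ʳ (edge K u v) (⇒∨ʳ (found v u) (found-complete u v u≡ v≤ (edge-sym G e)))
        ... | inj₁ u<1+k | inj₁ v<1+k = ⇒∨ˡ (edge-complete ok u v (ℕ.≤-pred u<1+k) (ℕ.≤-pred v<1+k) e)

  layer-correct : ∀ k K → Correct k K →
    layer k K within count (level (suc k)) * (searchCost + candidateCost) ensures Correct (suc k)
  layer-correct k K ok = ensures-≤ (ℕ.≤-reflexive (trans (cong (c * searchCost +_) (ℕ.+-identityʳ _))
                                                     (sym (ℕ.*-distribˡ-+ c searchCost candidateCost))))
    (ensures->>= (ensures-forEach {Φ = Parent} (level (suc k)) (parent-found ok)) λ p parent →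
     ensures->>= (ensures-forEach {Φ = λ v gv → ∀ u → candidates k (cluster K) p v u ≡ true → gv u ≡ D u v}
                    (level (suc k)) λ v _ → ensures-≤ (Step.candidates-few ok parent v) (ensures-askAll _ v)) λ g g≡ →
     ensures-ret (Step.extended-correct ok parent g≡))
    where
    c : ℕ
    c = count (level (suc k))

  -- The cost is charged per vertex of each layer; as the layers are disjoint, the charges add up to
  -- at most one per vertex.
  layers-correct : ∀ k → layers k within count (upTo k) * (searchCost + candidateCost) ensures Correct k
  layers-correct zero    = ensures-ret start-correct
  layers-correct (suc k) = ensures-≤ (begin
    count (upTo k) * c + count (level (suc k)) * c ≡⟨ ℕ.*-distribʳ-+ c (count (upTo k)) _ ⟨
    (count (upTo k) + count (level (suc k))) * c   ≤⟨ ℕ.*-monoˡ-≤ c (count-disjoint upTo⊑ level⊑ disjoint) ⟩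
    count (upTo (suc k)) * c                       ∎)
    (ensures->>= (layers-correct k) (layer-correct k))
    where
    open ℕ.≤-Reasoning
    c : ℕ
    c = searchCost + candidateCost
    upTo⊑ : upTo k ⊑ upTo (suc k)
    upTo⊑ v v≤k = dec-true (depth v ≤? suc k) (ℕ.m≤n⇒m≤1+n (does⇒ (depth v ≤? k) v≤k))
    level⊑ : level (suc k) ⊑ upTo (suc k)
    level⊑ v v≡ = dec-true (depth v ≤? suc k) (ℕ.≤-reflexive (level⇒ v≡))
    disjoint : ∀ v → upTo k v ≡ true → level (suc k) v ≢ true
    disjoint v v≤k v≡ = ℕ.<⇒≱ (ℕ.≤-reflexive (sym (level⇒ v≡))) (does⇒ (depth v ≤? k) v≤k)

-- Logarithms, the total cost and the final assembly

1≤⌈log₂⌉ : ∀ n → 1 ≤ ⌈log₂ suc (suc n) ⌉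
1≤⌈log₂⌉ n = ⌈log₂⌉-mono-≤ {2} {suc (suc n)} (s≤s (s≤s z≤n))

n≤2^⌈log₂n⌉ : ∀ n → n ≤ 2 ^ ⌈log₂ n ⌉
n≤2^⌈log₂n⌉ = <-rec _ halve
  where
  open ℕ.≤-Reasoning
  halve : ∀ n → (∀ {k} → k < n → k ≤ 2 ^ ⌈log₂ k ⌉) → n ≤ 2 ^ ⌈log₂ n ⌉
  halve zero          _  = z≤n
  halve (suc zero)    _  = ℕ.≤-refl
  halve (suc (suc n)) ih = let N = suc (suc n) in begin
    N                       ≡⟨ ℕ.⌊n/2⌋+⌈n/2⌉≡n N ⟨
    ℕ.⌊ N /2⌋ + ⌈ N /2⌉     ≤⟨ ℕ.+-monoˡ-≤ ⌈ N /2⌉ (ℕ.⌊n/2⌋≤⌈n/2⌉ N) ⟩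
    ⌈ N /2⌉ + ⌈ N /2⌉       ≡⟨ cong (⌈ N /2⌉ +_) (ℕ.+-identityʳ _) ⟨
    2 * ⌈ N /2⌉             ≤⟨ ℕ.*-monoʳ-≤ 2 (ih (ℕ.⌈n/2⌉<n n)) ⟩
    2 * 2 ^ ⌈log₂ ⌈ N /2⌉ ⌉ ≡⟨ cong (λ l → 2 ^ suc l) (⌈log₂⌈n/2⌉⌉≡⌈log₂n⌉∸1 N) ⟩
    2 ^ suc (⌈log₂ N ⌉ ∸ 1) ≡⟨ cong (2 ^_) (ℕ.m+[n∸m]≡n (1≤⌈log₂⌉ n)) ⟩
    2 ^ ⌈log₂ N ⌉           ∎

≡true-ext : ∀ a b → (a ≡ true → b ≡ true) → (b ≡ true → a ≡ true) → a ≡ b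
≡true-ext true  b     a⇒b _   = sym (a⇒b refl)
≡true-ext false true  _   b⇒a = b⇒a refl
≡true-ext false false _   _   = refl

connected⇒1≤maxDegree : ∀ {n} (G : Graph (suc (suc n))) → Connected G → 1 ≤ maxDegree G
connected⇒1≤maxDegree G connected with connected zero (suc zero)
... | _ , step {w = w} e _ = ℕ.≤-trans (count-positive {f = adj G zero} w e) (neighbours G zero)

-- With `E` for the power of `Δ` on the right, the constant is 8 = 1 + 3 + 2 + 2: the depth queries,
-- the searches (cuts 2, children 1), and the candidates in the previous and in the own layer.
total-cost : ∀ N Δ τ L → 1 ≤ Δ → 1 ≤ L →
  N + (N * (L * (2 * Δ ^ τ + Δ) + (2 * Δ ^ (3 * τ) + 2 * Δ ^ (3 * τ) * Δ)) + 0) ≤ 8 * Δ ^ (3 * τ + 2) * N * L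
total-cost N Δ@(suc _) τ L 1≤Δ 1≤L = begin
  N + (N * (L * (2 * Δ ^ τ + Δ) + (2 * Δ ^ (3 * τ) + 2 * Δ ^ (3 * τ) * Δ)) + 0)
    ≡⟨ cong (N +_) (ℕ.+-identityʳ _) ⟩
  N + N * (L * (2 * Δ ^ τ + Δ) + (2 * Δ ^ (3 * τ) + 2 * Δ ^ (3 * τ) * Δ))
    ≤⟨ ℕ.+-mono-≤ N≤ (ℕ.*-monoʳ-≤ N (ℕ.+-mono-≤ (ℕ.*-monoʳ-≤ L (ℕ.+-mono-≤ (ℕ.*-monoʳ-≤ 2 (pow τ≤)) Δ≤))
         (ℕ.+-mono-≤ (≤E*L (ℕ.*-monoʳ-≤ 2 (pow (ℕ.m≤m+n (3 * τ) 2))))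
           (≤E*L (ℕ.≤-trans (ℕ.≤-reflexive 2ΔΔ) (ℕ.*-monoʳ-≤ 2 (pow 3τ+1≤))))))) ⟩
  N * (E * L) + N * (L * (2 * E + E) + (2 * E * L + 2 * E * L))
    ≡⟨ solve 3 (λ N E L → N :* (E :* L) :+ N :* (L :* (con 2 :* E :+ E) :+ (con 2 :* E :* L :+ con 2 :* E :* L))
                       := con 8 :* E :* N :* L) refl N E L ⟩
  8 * E * N * L ∎
  where
  open ℕ.≤-Reasoning
  open +-*-Solver
  E : ℕ
  E = Δ ^ (3 * τ + 2)
  pow : ∀ {a} → a ≤ 3 * τ + 2 → Δ ^ a ≤ E
  pow = ℕ.^-monoʳ-≤ Δ
  τ≤ : τ ≤ 3 * τ + 2
  τ≤ = ℕ.≤-trans (ℕ.m≤m+n τ _) (ℕ.m≤m+n (3 * τ) 2)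
  3τ+1≤ : suc (3 * τ) ≤ 3 * τ + 2
  3τ+1≤ = ℕ.≤-trans (ℕ.≤-reflexive (ℕ.+-comm 1 (3 * τ))) (ℕ.+-monoʳ-≤ (3 * τ) (s≤s z≤n))
  Δ≤ : Δ ≤ E
  Δ≤ = ℕ.≤-trans (ℕ.≤-reflexive (sym (ℕ.*-identityʳ Δ))) (pow (ℕ.≤-trans (s≤s z≤n) (ℕ.m≤n+m 2 (3 * τ))))
  ≤E*L : ∀ {a c} → a ≤ c → a ≤ c * L
  ≤E*L {a} {c} a≤c = ℕ.≤-trans a≤c (ℕ.≤-trans (ℕ.≤-reflexive (sym (ℕ.*-identityʳ c))) (ℕ.*-monoʳ-≤ c 1≤L))
  N≤ : N ≤ N * (E * L)
  N≤ = ℕ.≤-trans (ℕ.≤-reflexive (sym (ℕ.*-identityʳ N))) (ℕ.*-monoʳ-≤ N (≤E*L (pow z≤n)))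
  2ΔΔ : 2 * Δ ^ (3 * τ) * Δ ≡ 2 * Δ ^ suc (3 * τ)
  2ΔΔ = trans (ℕ.*-assoc 2 (Δ ^ (3 * τ)) Δ) (cong (2 *_) (ℕ.*-comm (Δ ^ (3 * τ)) Δ))

reconstruct-correct : ∀ n (G : Graph n) (D : Fin n → Fin n → ℕ) → IsDistOracle G D → Connected G →
  ∀ τ → TreeLengthAtMost G τ → let open Semantics D in
  reconstruct n τ within 8 * maxDegree G ^ (3 * τ + 2) * n * ⌈log₂ n ⌉ ensures λ E → ∀ u v → E u v ≡ adj G u v
reconstruct-correct zero          G D isD connected τ _ = Semantics.ensures-ret D λ ()
reconstruct-correct (suc zero)    G D isD connected τ _ = Semantics.ensures-ret D
  λ { zero zero → sym (Graph.irrefl G zero) }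
reconstruct-correct (suc (suc n)) G D isD connected τ (TD , bag≤τ) =
  ensures-≤ (total-cost N (maxDegree G) τ ⌈log₂ N ⌉ 1≤Δ (1≤⌈log₂⌉ n))
    (ensures->>= probed λ depth depth≡ →
     ensures->>= (layered depth depth≡) λ K exact → ensures-ret exact)
  where
  open Semantics D
  open Metric G D isD
  N L Δ : ℕ
  N = suc (suc n)
  L = ⌈log₂ N ⌉
  Δ = maxDegree G
  1≤Δ : 1 ≤ Δ
  1≤Δ = connected⇒1≤maxDegree G connected
  probed : askAll (λ _ → true) zero within N ensures λ depth → ∀ x → depth x ≡ D zero x
  probed = ensures-≤ (count≤n {N} (λ _ → true))
    (ensures-map (λ g≡ x → trans (g≡ x refl) (D-sym x zero)) (ensures-askAll (λ _ → true) zero))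
  layered : ∀ depth → (∀ x → depth x ≡ D zero x) → Layering.layers τ L zero depth (maxOver depth)
    within N * (L * (2 * Δ ^ τ + Δ) + (2 * Δ ^ (3 * τ) + 2 * Δ ^ (3 * τ) * Δ))
    ensures λ K → ∀ u v → edge K u v ≡ adj G u v
  layered depth depth≡ = ensures-≤ (ℕ.*-monoˡ-≤ (searchCost + candidateCost) (count≤n (upTo (maxOver depth))))
    -- No vertex is deeper than `maxOver depth`, so after that layer soundness and completeness
    -- cover every pair.
    (ensures-map (λ ok u v → ≡true-ext _ _ (edge-sound ok u v)
        (edge-complete ok u v (maxOver-upper depth u) (maxOver-upper depth v)))
      (layers-correct (maxOver depth)))
    where
    open Layering τ L zero depth using (upTo)
    open LayeringCorrect G D isD 1≤Δ TD (λ t u v tu tv → bag≤τ t u v tu tv (D u v) (isD u v))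
      L (n≤2^⌈log₂n⌉ N) zero depth depth≡
    open Correct

theorem1 : Σ Algorithm λ A → Σ ℕ λ C →
    ∀ (n : ℕ) (G : Graph n) (D : _) → IsDistOracle G D → Connected G →
    ∀ (τ : ℕ) → TreeLengthAtMost G τ →
    (∀ u v → proj₁ (run (A n τ) D) u v ≡ adj G u v) ×
    proj₂ (run (A n τ) D) ≤ C * maxDegree G ^ (3 * τ + 2) * n * ⌈log₂ n ⌉
theorem1 = (λ n τ → toQueryTree (reconstruct n τ)) , 8 , λ n G D isD connected τ tl →
  let open Semantics D
      open _within_ensures_ (reconstruct-correct n G D isD connected τ tl)
      p = reconstruct n τ
  in (λ u v → trans (cong (λ E → E u v) (run-value p)) (holds u v)) ,
     ℕ.≤-trans (ℕ.≤-reflexive (run-cost p)) bounded
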